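{- Let $a=(a_i)_{i\in\mathbb Z}$ be any sequence of complex numbers and $\mu$ a Young diagram. Then $$s_{\mu;a}(x(\mu);y(\mu))=\prod_{(i,j)\in\mu}(a_{\mu_i-i+1}-a_{j-\mu'_j})=\prod_{(i,j)\in\mu}(a_{\mu_i-i+1}+\widehat a_{\mu'_j-j+1}),$$ the products being over the boxes $(i,j)$ (row $i$, column $j$) of $\mu$. If the numbers $a_i$, $i\in\mathbb Z$, are pairwise distinct, then $s_{\mu;a}(x(\mu);y(\mu))\ne0$ for all $\mu$.
   Context: $\Lambda$ is the algebra of symmetric functions over $\mathbb C$ with complete homogeneous $h_k$, elementary $e_k$, power sums $\mathbf p_k$. For a sequence $a$ define $h_{k;a}=\sum_{i=1}^k(-1)^{k-i}e_{k-i}(a_1,\dots,a_{k-1})h_i$ ($k\ge1$), $h_{0;a}=1$, $h_{k;a}=0$ ($k<0$); $(\tau^ra)_i=a_{i+r}$; $s_{\mu;a}=\det[h_{\mu_i-i+j;\,\tau^{1-j}a}]_{i,j=1}^N$ for any $N\ge\ell(\mu)$. Dual sequence: $\widehat a_i=-a_{1-i}$. $\mu'$ is the transposed diagram. Each $f\in\Lambda$ is evaluated at $(x;y)\in\mathbb C^d\times\mathbb C^d$ via $\mathbf p_k\mapsto\sum_ix_i^k+(-1)^{k-1}\sum_jy_j^k$. For a nonempty diagram $\lambda=(p_1,\dots,p_d\mid q_1,\dots,q_d)$ in Frobenius notation ($p_i=\lambda_i-i$, $q_i=\lambda'_i-i$, $d$ the number of diagonal boxes), $(x(\lambda);y(\lambda))=(a_{p_1+1},\dots,a_{p_d+1};\widehat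 a_{q_1+1},\dots,\widehat a_{q_d+1})$; and $(x(\varnothing);y(\varnothing))=(0;0)$. -}

module Defs where

open import Algebra.Apartness.Bundles using (HeytingField; HeytingCommutativeRing)
open import Algebra.Bundles using (CommutativeRing; Semiring)
import Algebra.Definitions.RawSemiring as RawSemiringDefinitions
import Algebra.Properties.CommutativeMonoid.Sum as CommutativeMonoidSum
open import Algebra.Morphism.Structures using (module RingMorphisms)
open import Data.Fin.Base using (Fin; zero; suc; toℕ; punchIn)
open import Data.Fin.Permutation using (Permutation′; _⟨$⟩ʳ_)
open import Data.Integer.Base as ℤ using (ℤ; +_; -[1+_]; 1ℤ; _⊖_)
open import Data.List.Base as List using (List; []; _∷_; _++_; map; foldr; length; filter; applyUpTo; concatMap; tabulate)
import Data.List.Properties as Listₚ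
open import Data.List.Relation.Binary.Permutation.Propositional as Perm using (_↭_; ↭-sym; ↭-reflexive; ↭-trans)
open import Data.List.Relation.Binary.Permutation.Propositional.Properties using (++-commutativeMonoid)
open import Data.List.Relation.Unary.All as All using (All; []; _∷_)
import Data.List.Relation.Unary.All.Properties as Allₚ
open import Data.List.Relation.Unary.Linked using (Linked)
open import Data.Nat.Base as ℕ using (ℕ; zero; suc; pred; _∸_; _≤_; _<_; _≥_; z≤n; s≤s; NonZero)
import Data.Nat.Properties as ℕₚ
open import Data.Product.Base using (∃; _×_; _,_; proj₁; proj₂)
open import Data.Vec.Functional using (Vector)
open import Function.Base using (_∘_)
open import Level using (Level; _⊔_)
open import Relation.Nullary.Negation using (¬_)
open import Relation.Binary.PropositionalEquality as ≡ using (_≡_)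
import Relation.Binary.Reasoning.Setoid as SetoidReasoning

private
  variable
    b c ℓ ℓ₁ ℓ₂ : Level
    A : Set b
    B : Set c
    m n : ℕ

fieldRing : HeytingField c ℓ₁ ℓ₂ → CommutativeRing c ℓ₁
fieldRing K = HeytingCommutativeRing.commutativeRing (HeytingField.heytingCommutativeRing K)

CharacteristicZero : CommutativeRing c ℓ → Set ℓ
CharacteristicZero R = ∀ n → ¬ ((suc n ×ᴿ 1#) ≈ 0#)
  where
  open CommutativeRing R hiding (zero)
  open RawSemiringDefinitions (Semiring.rawSemiring semiring) using () renaming (_×_ to _×ᴿ_)

[1⋯_] : ℕ → List ℕ
[1⋯ n ] = applyUpTo suc n

-- sublists of length k: the monomials of e_k
choose : ℕ → List A → List (List A)
choose zero    _        = [] ∷ []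
choose (suc k) []       = []
choose (suc k) (x ∷ xs) = map (x ∷_) (choose k xs) ++ choose (suc k) xs

-- sublists of length k with repetition allowed: the monomials of h_k
multichoose : ℕ → List A → List (List A)
multichoose zero    _        = [] ∷ []
multichoose (suc k) []       = []
multichoose (suc k) (x ∷ xs) = map (x ∷_) (multichoose k (x ∷ xs)) ++ multichoose (suc k) xs

private
  multichoose-map : (f : A → B) → ∀ k xs →
                    multichoose k (map f xs) ≡ map (map f) (multichoose k xs)
  multichoose-map f zero    xs       = ≡.refl
  multichoose-map f (suc k) []       = ≡.refl
  multichoose-map f (suc k) (x ∷ xs) = begin
    map (f x ∷_) (multichoose k (f x ∷ map f xs)) ++ multichoose (suc k) (map f xs)
      ≡⟨ ≡.cong₂ (λ u v → map (f x ∷_) u ++ v)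
           (multichoose-map f k (x ∷ xs)) (multichoose-map f (suc k) xs) ⟩
    map (f x ∷_) (map (map f) (multichoose k (x ∷ xs))) ++ map (map f) (multichoose (suc k) xs)
      ≡⟨ ≡.cong (_++ _) (≡.sym (Listₚ.map-∘ (multichoose k (x ∷ xs)))) ⟩
    map (map f ∘ (x ∷_)) (multichoose k (x ∷ xs)) ++ map (map f) (multichoose (suc k) xs)
      ≡⟨ ≡.cong (_++ _) (Listₚ.map-∘ (multichoose k (x ∷ xs))) ⟩
    map (map f) (map (x ∷_) (multichoose k (x ∷ xs))) ++ map (map f) (multichoose (suc k) xs)
      ≡⟨ Listₚ.map-++ (map f) (map (x ∷_) (multichoose k (x ∷ xs))) (multichoose (suc k) xs) ⟨
    map (map f) (multichoose (suc k) (x ∷ xs)) ∎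
    where open ≡.≡-Reasoning

  tabulate-permute : (f : Fin n → A) (σ : Permutation′ n) →
                     tabulate (f ∘ (σ ⟨$⟩ʳ_)) ↭ tabulate f
  tabulate-permute {A = A} f σ =
    ↭-trans (↭-reflexive (toSum (f ∘ (σ ⟨$⟩ʳ_))))
      (↭-trans (↭-sym (sum-permute (λ i → f i ∷ []) σ)) (↭-reflexive (≡.sym (toSum f))))
    where
    open CommutativeMonoidSum (++-commutativeMonoid {A = A}) using (sum; sum-permute)
    toSum : ∀ {n} (g : Fin n → A) → tabulate g ≡ sum (λ i → g i ∷ [])
    toSum {zero}  g = ≡.refl
    toSum {suc n} g = ≡.cong (g zero ∷_) (toSum (g ∘ suc))

module OverRing (R : CommutativeRing c ℓ) where

  open CommutativeRing R hiding (zero)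
  open RawSemiringDefinitions (Semiring.rawSemiring semiring) public using (sum; _^_)

  ∑ ∏ : List A → (A → Carrier) → Carrier
  ∑ xs f = foldr _+_ 0# (map f xs)
  ∏ xs f = foldr _*_ 1# (map f xs)

  elementary complete powerSum : ℕ → List Carrier → Carrier
  elementary k xs = ∑ (choose k xs) (foldr _*_ 1#)
  complete   k xs = ∑ (multichoose k xs) (foldr _*_ 1#)
  powerSum   k xs = ∑ xs (_^ k)

  -- Laplace expansion along the first row
  det : (Fin n → Fin n → Carrier) → Carrier
  det {zero}  M = 1#
  det {suc n} M =
    sum (λ j → (- 1#) ^ toℕ j * (M zero j * det (λ r s → M (suc r) (punchIn j s))))

  private
    open SetoidReasoning setoid

    swapˡ : ∀ x y z → x + (y + z) ≈ y + (x + z)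
    swapˡ x y z = begin
      x + (y + z) ≈⟨ +-assoc x y z ⟨
      (x + y) + z ≈⟨ +-congʳ (+-comm x y) ⟩
      (y + x) + z ≈⟨ +-assoc y x z ⟩
      y + (x + z) ∎

    cons-sum : ∀ x (u v : List (List Carrier)) →
      ∑ (map (x ∷_) u ++ v) (foldr _*_ 1#) ≈ x * ∑ u (foldr _*_ 1#) + ∑ v (foldr _*_ 1#)
    cons-sum x []       v = sym (trans (+-congʳ (zeroʳ x)) (+-identityˡ _))
    cons-sum x (t ∷ u) v = begin
      x * foldr _*_ 1# t + ∑ (map (x ∷_) u ++ v) (foldr _*_ 1#)
        ≈⟨ +-congˡ (cons-sum x u v) ⟩
      x * foldr _*_ 1# t + (x * ∑ u (foldr _*_ 1#) + ∑ v (foldr _*_ 1#))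
        ≈⟨ +-assoc _ _ _ ⟨
      (x * foldr _*_ 1# t + x * ∑ u (foldr _*_ 1#)) + ∑ v (foldr _*_ 1#)
        ≈⟨ +-congʳ (distribˡ x _ _) ⟨
      x * (foldr _*_ 1# t + ∑ u (foldr _*_ 1#)) + ∑ v (foldr _*_ 1#) ∎

  complete-step : ∀ k x xs →
    complete (suc k) (x ∷ xs) ≈ x * complete k (x ∷ xs) + complete (suc k) xs
  complete-step k x xs = cons-sum x (multichoose k (x ∷ xs)) (multichoose (suc k) xs)

  complete-0 : ∀ k xs → complete k (0# ∷ xs) ≈ complete k xs
  complete-0 zero    xs = refl
  complete-0 (suc k) xs =
    trans (complete-step k 0# xs) (trans (+-congʳ (zeroˡ _)) (+-identityˡ _))

  powerSum-0 : ∀ k .{{_ : NonZero k}} xs → powerSum k (0# ∷ xs) ≈ powerSum k xs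
  powerSum-0 (suc k) xs = trans (+-congʳ (zeroˡ _)) (+-identityˡ _)

  private
    complete-prep : ∀ x {xs ys} → (∀ k → complete k xs ≈ complete k ys) →
                    ∀ k → complete k (x ∷ xs) ≈ complete k (x ∷ ys)
    complete-prep x p zero    = refl
    complete-prep x {xs} {ys} p (suc k) = begin
      complete (suc k) (x ∷ xs)                     ≈⟨ complete-step k x xs ⟩
      x * complete k (x ∷ xs) + complete (suc k) xs ≈⟨ +-cong (*-congˡ (complete-prep x p k)) (p (suc k)) ⟩
      x * complete k (x ∷ ys) + complete (suc k) ys ≈⟨ complete-step k x ys ⟨
      complete (suc k) (x ∷ ys)                     ∎

    -- (x - y) h_k(x, y, …) + y h_k(y, …) = x h_k(x, …), without subtraction
    complete-exchange : ∀ k x y xs →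
      x * complete k (x ∷ y ∷ xs) + y * complete k (y ∷ xs) ≈
      x * complete k (x ∷ xs) + y * complete k (x ∷ y ∷ xs)
    complete-exchange zero    x y xs = refl
    complete-exchange (suc k) x y xs = begin
      x * complete (suc k) (x ∷ y ∷ xs) + y * Hy
        ≈⟨ +-congʳ (*-congˡ (complete-step k x (y ∷ xs))) ⟩
      x * (x * hxy + Hy) + y * Hy
        ≈⟨ +-congʳ (*-congˡ (+-congˡ (complete-step k y xs))) ⟩
      x * (x * hxy + (y * hy + H)) + y * Hy
        ≈⟨ +-congʳ (*-congˡ (+-assoc _ _ _)) ⟨
      x * ((x * hxy + y * hy) + H) + y * Hy
        ≈⟨ +-congʳ (*-congˡ (+-congʳ (complete-exchange k x y xs))) ⟩
      x * ((x * hx + y * hxy) + H) + y * Hy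
        ≈⟨ +-congʳ (*-congˡ (trans (+-assoc _ _ _) (trans (swapˡ _ _ _) (+-congˡ (sym (complete-step k x xs)))))) ⟩
      x * (y * hxy + Hx) + y * Hy
        ≈⟨ +-congʳ (distribˡ x _ _) ⟩
      (x * (y * hxy) + x * Hx) + y * Hy
        ≈⟨ +-congʳ (+-comm _ _) ⟩
      (x * Hx + x * (y * hxy)) + y * Hy
        ≈⟨ +-assoc _ _ _ ⟩
      x * Hx + (x * (y * hxy) + y * Hy)
        ≈⟨ +-congˡ (+-congʳ (trans (sym (*-assoc x y hxy)) (trans (*-congʳ (*-comm x y)) (*-assoc y x hxy)))) ⟩
      x * Hx + (y * (x * hxy) + y * Hy)
        ≈⟨ +-congˡ (distribˡ y _ _) ⟨
      x * Hx + y * (x * hxy + Hy)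
        ≈⟨ +-congˡ (*-congˡ (complete-step k x (y ∷ xs))) ⟨
      x * Hx + y * complete (suc k) (x ∷ y ∷ xs) ∎
      where
      hxy = complete k (x ∷ y ∷ xs)
      hx  = complete k (x ∷ xs)
      hy  = complete k (y ∷ xs)
      H   = complete (suc k) xs
      Hx  = complete (suc k) (x ∷ xs)
      Hy  = complete (suc k) (y ∷ xs)

    complete-swap : ∀ k x y xs → complete k (x ∷ y ∷ xs) ≈ complete k (y ∷ x ∷ xs)
    complete-swap zero    x y xs = refl
    complete-swap (suc k) x y xs = begin
      complete (suc k) (x ∷ y ∷ xs)
        ≈⟨ complete-step k x (y ∷ xs) ⟩
      x * complete k (x ∷ y ∷ xs) + complete (suc k) (y ∷ xs)
        ≈⟨ +-congˡ (complete-step k y xs) ⟩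
      x * complete k (x ∷ y ∷ xs) + (y * complete k (y ∷ xs) + complete (suc k) xs)
        ≈⟨ +-assoc _ _ _ ⟨
      (x * complete k (x ∷ y ∷ xs) + y * complete k (y ∷ xs)) + complete (suc k) xs
        ≈⟨ +-congʳ (complete-exchange k x y xs) ⟩
      (x * complete k (x ∷ xs) + y * complete k (x ∷ y ∷ xs)) + complete (suc k) xs
        ≈⟨ +-congʳ (+-congˡ (*-congˡ (complete-swap k x y xs))) ⟩
      (x * complete k (x ∷ xs) + y * complete k (y ∷ x ∷ xs)) + complete (suc k) xs
        ≈⟨ +-congʳ (+-comm _ _) ⟩
      (y * complete k (y ∷ x ∷ xs) + x * complete k (x ∷ xs)) + complete (suc k) xs
        ≈⟨ +-assoc _ _ _ ⟩
      y * complete k (y ∷ x ∷ xs) + (x * complete k (x ∷ xs) + complete (suc k) xs)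
        ≈⟨ +-congˡ (complete-step k x xs) ⟨
      y * complete k (y ∷ x ∷ xs) + complete (suc k) (x ∷ xs)
        ≈⟨ complete-step k y (x ∷ xs) ⟨
      complete (suc k) (y ∷ x ∷ xs) ∎

  complete-↭ : ∀ {xs ys} → xs ↭ ys → ∀ k → complete k xs ≈ complete k ys
  complete-↭ Perm.refl          k = refl
  complete-↭ (Perm.prep x p)    k = complete-prep x (complete-↭ p) k
  complete-↭ (Perm.swap x y p)  k =
    trans (complete-swap k x y _) (complete-prep y (complete-prep x (complete-↭ p)) k)
  complete-↭ (Perm.trans p q)   k = trans (complete-↭ p k) (complete-↭ q k)

  powerSum-↭ : ∀ {xs ys} → xs ↭ ys → ∀ k → powerSum k xs ≈ powerSum k ys
  powerSum-↭ Perm.refl         k = refl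
  powerSum-↭ (Perm.prep x p)   k = +-congˡ (powerSum-↭ p k)
  powerSum-↭ (Perm.swap x y p) k =
    trans (swapˡ _ _ _) (+-congˡ (+-congˡ (powerSum-↭ p k)))
  powerSum-↭ (Perm.trans p q)  k = trans (powerSum-↭ p k) (powerSum-↭ q k)

-- The polynomial ring K[x₁,…,xₙ] as the free commutative
-- K-algebra on Fin n, i.e. ring terms modulo the axioms of commutative
-- K-algebras.
module Polynomials (K : CommutativeRing c ℓ) where

  private module K = CommutativeRing K

  infix  8 -_
  infixl 7 _*_
  infixl 6 _+_
  infix  4 _≋_

  data Poly (n : ℕ) : Set c where
    con     : K.Carrier → Poly n
    var     : Fin n → Poly n
    _+_ _*_ : Poly n → Poly n → Poly n
    -_      : Poly n → Poly n

  data _≋_ {n : ℕ} : Poly n → Poly n → Set (c ⊔ ℓ) where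
    ≋-refl     : ∀ {f} → f ≋ f
    ≋-sym      : ∀ {f g} → f ≋ g → g ≋ f
    ≋-trans    : ∀ {f g h} → f ≋ g → g ≋ h → f ≋ h
    +-cong     : ∀ {f f′ g g′} → f ≋ f′ → g ≋ g′ → f + g ≋ f′ + g′
    *-cong     : ∀ {f f′ g g′} → f ≋ f′ → g ≋ g′ → f * g ≋ f′ * g′
    -‿cong     : ∀ {f f′} → f ≋ f′ → - f ≋ - f′
    +-assoc    : ∀ f g h → (f + g) + h ≋ f + (g + h)
    +-comm     : ∀ f g → f + g ≋ g + f
    +-identity : ∀ f → con K.0# + f ≋ f
    +-inverse  : ∀ f → - f + f ≋ con K.0#
    *-assoc    : ∀ f g h → (f * g) * h ≋ f * (g * h)
    *-comm     : ∀ f g → f * g ≋ g * f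
    *-identity : ∀ f → con K.1# * f ≋ f
    distrib    : ∀ f g h → (g + h) * f ≋ g * f + h * f
    con-cong   : ∀ {k l} → k K.≈ l → con k ≋ con l
    con-+      : ∀ k l → con (k K.+ l) ≋ con k + con l
    con-*      : ∀ k l → con (k K.* l) ≋ con k * con l

  polyRing : ℕ → CommutativeRing c (c ⊔ ℓ)
  polyRing n = record
    { Carrier = Poly n ; _≈_ = _≋_ ; _+_ = _+_ ; _*_ = _*_ ; -_ = -_
    ; 0# = con K.0# ; 1# = con K.1#
    ; isCommutativeRing = record
      { isRing = record
        { +-isAbelianGroup = record
          { isGroup = record
            { isMonoid = record
              { isSemigroup = record
                { isMagma = record
                  { isEquivalence = record { refl = ≋-refl ; sym = ≋-sym ; trans = ≋-trans }
                  ; ∙-cong = +-cong }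
                ; assoc = +-assoc }
              ; identity = +-identity , λ f → ≋-trans (+-comm f _) (+-identity f) }
            ; inverse = +-inverse , λ f → ≋-trans (+-comm f _) (+-inverse f)
            ; ⁻¹-cong = -‿cong }
          ; comm = +-comm }
        ; *-cong = *-cong
        ; *-assoc = *-assoc
        ; *-identity = *-identity , λ f → ≋-trans (*-comm f _) (*-identity f)
        ; distrib = (λ f g h → ≋-trans (*-comm f _)
                      (≋-trans (distrib f g h) (+-cong (*-comm g f) (*-comm h f))))
                  , distrib }
      ; *-comm = *-comm } }

  substitute : (Fin m → Poly n) → Poly m → Poly n
  substitute θ (con k) = con k
  substitute θ (var i) = θ i
  substitute θ (f + g) = substitute θ f + substitute θ g
  substitute θ (f * g) = substitute θ f * substitute θ g
  substitute θ (- f)   = - substitute θ f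

  substitute-cong : (θ : Fin m → Poly n) → ∀ {f g} → f ≋ g → substitute θ f ≋ substitute θ g
  substitute-cong θ ≋-refl           = ≋-refl
  substitute-cong θ (≋-sym p)        = ≋-sym (substitute-cong θ p)
  substitute-cong θ (≋-trans p q)    = ≋-trans (substitute-cong θ p) (substitute-cong θ q)
  substitute-cong θ (+-cong p q)     = +-cong (substitute-cong θ p) (substitute-cong θ q)
  substitute-cong θ (*-cong p q)     = *-cong (substitute-cong θ p) (substitute-cong θ q)
  substitute-cong θ (-‿cong p)       = -‿cong (substitute-cong θ p)
  substitute-cong θ (+-assoc f g h)  = +-assoc _ _ _
  substitute-cong θ (+-comm f g)     = +-comm _ _
  substitute-cong θ (+-identity f)   = +-identity _
  substitute-cong θ (+-inverse f)    = +-inverse _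
  substitute-cong θ (*-assoc f g h)  = *-assoc _ _ _
  substitute-cong θ (*-comm f g)     = *-comm _ _
  substitute-cong θ (*-identity f)   = *-identity _
  substitute-cong θ (distrib f g h)  = distrib _ _ _
  substitute-cong θ (con-cong p)     = con-cong p
  substitute-cong θ (con-+ k l)      = con-+ k l
  substitute-cong θ (con-* k l)      = con-* k l

  permute : Permutation′ n → Poly n → Poly n
  permute σ = substitute (var ∘ (σ ⟨$⟩ʳ_))

  -- The variable `zero` of Poly (suc n) plays the role of x_{n+1}, and
  -- `suc i` that of the variable i of Poly n.
  setLast : K.Carrier → Fin (suc n) → Poly n
  setLast k zero    = con k
  setLast k (suc i) = var i

  termDegree : Poly n → ℕ
  termDegree (con k) = 0
  termDegree (var i) = 1
  termDegree (f + g) = termDegree f ℕ.⊔ termDegree g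
  termDegree (f * g) = termDegree f ℕ.+ termDegree g
  termDegree (- f)   = termDegree f

  -- Terms over-estimate the degree (e.g. x - x), hence the choice of a
  -- representative.
  Degree≤ : ℕ → Poly n → Set (c ⊔ ℓ)
  Degree≤ d f = ∃ λ g → g ≋ f × termDegree g ≤ d

-- The algebra Λ of symmetric functions over K: the inverse limit, in the
-- category of graded rings, of the algebras of symmetric polynomials in
-- x₁,…,xₙ along the maps x_{n+1} ↦ 0.
module SymmetricFunctions (K : CommutativeRing c ℓ) where

  private module K = CommutativeRing K
  open Polynomials K

  record Λ : Set (c ⊔ ℓ) where
    field
      poly      : ∀ n → Poly n
      symmetric : ∀ n (σ : Permutation′ n) → permute σ (poly n) ≋ poly n
      stable    : ∀ n → substitute (setLast K.0#) (poly (suc n)) ≋ poly n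
      bounded   : ∃ λ d → ∀ n → Degree≤ d (poly n)

  open Λ

  infix  4 _≈Λ_
  _≈Λ_ : Λ → Λ → Set (c ⊔ ℓ)
  f ≈Λ g = ∀ n → poly f n ≋ poly g n

  const : K.Carrier → Λ
  const k = record
    { poly      = λ n → con k
    ; symmetric = λ n σ → ≋-refl
    ; stable    = λ n → ≋-refl
    ; bounded   = 0 , λ n → con k , ≋-refl , z≤n
    }

  private
    _+Λ_ _*Λ_ : Λ → Λ → Λ
    f +Λ g = record
      { poly      = λ n → poly f n + poly g n
      ; symmetric = λ n σ → +-cong (symmetric f n σ) (symmetric g n σ)
      ; stable    = λ n → +-cong (stable f n) (stable g n)
      ; bounded   = proj₁ (bounded f) ℕ.⊔ proj₁ (bounded g) , λ n →
          let (f′ , p , d) = proj₂ (bounded f) n ; (g′ , q , e) = proj₂ (bounded g) n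
          in f′ + g′ , +-cong p q , ℕₚ.⊔-mono-≤ d e
      }
    f *Λ g = record
      { poly      = λ n → poly f n * poly g n
      ; symmetric = λ n σ → *-cong (symmetric f n σ) (symmetric g n σ)
      ; stable    = λ n → *-cong (stable f n) (stable g n)
      ; bounded   = proj₁ (bounded f) ℕ.+ proj₁ (bounded g) , λ n →
          let (f′ , p , d) = proj₂ (bounded f) n ; (g′ , q , e) = proj₂ (bounded g) n
          in f′ * g′ , *-cong p q , ℕₚ.+-mono-≤ d e
      }

    -Λ_ : Λ → Λ
    -Λ f = record
      { poly      = λ n → - poly f n
      ; symmetric = λ n σ → -‿cong (symmetric f n σ)
      ; stable    = λ n → -‿cong (stable f n)
      ; bounded   = proj₁ (bounded f) , λ n →
          let (f′ , p , d) = proj₂ (bounded f) n in - f′ , -‿cong p , d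
      }

  ΛRing : CommutativeRing (c ⊔ ℓ) (c ⊔ ℓ)
  ΛRing = record
    { Carrier = Λ ; _≈_ = _≈Λ_ ; _+_ = _+Λ_ ; _*_ = _*Λ_ ; -_ = -Λ_
    ; 0# = const K.0# ; 1# = const K.1#
    ; isCommutativeRing = record
      { isRing = record
        { +-isAbelianGroup = record
          { isGroup = record
            { isMonoid = record
              { isSemigroup = record
                { isMagma = record
                  { isEquivalence = record
                    { refl  = λ n → ≋-refl
                    ; sym   = λ p n → ≋-sym (p n)
                    ; trans = λ p q n → ≋-trans (p n) (q n) }
                  ; ∙-cong = λ p q n → +-cong (p n) (q n) }
                ; assoc = λ f g h n → P.+-assoc n _ _ _ }
              ; identity = (λ f n → P.+-identityˡ n _) , (λ f n → P.+-identityʳ n _) }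
            ; inverse = (λ f n → P.-‿inverseˡ n _) , (λ f n → P.-‿inverseʳ n _)
            ; ⁻¹-cong = λ p n → -‿cong (p n) }
          ; comm = λ f g n → P.+-comm n _ _ }
        ; *-cong = λ p q n → *-cong (p n) (q n)
        ; *-assoc = λ f g h n → P.*-assoc n _ _ _
        ; *-identity = (λ f n → P.*-identityˡ n _) , (λ f n → P.*-identityʳ n _)
        ; distrib = (λ f g h n → P.distribˡ n _ _ _) , (λ f g h n → P.distribʳ n _ _ _) }
      ; *-comm = λ f g n → P.*-comm n _ _ } }
    where module P n = CommutativeRing (polyRing n)

  private
    module E n = OverRing (polyRing n)

    vars : ∀ n → List (Poly n)
    vars n = tabulate var

    ∑-substitute : (θ : Fin m → Poly n) → {F : A → Poly m} {G : A → Poly n} →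
      (∀ x → substitute θ (F x) ≡ G x) → ∀ xs → substitute θ (E.∑ m xs F) ≡ E.∑ n xs G
    ∑-substitute θ p []       = ≡.refl
    ∑-substitute θ p (x ∷ xs) = ≡.cong₂ _+_ (p x) (∑-substitute θ p xs)

    ∏-substitute : (θ : Fin m → Poly n) → ∀ xs →
      substitute θ (foldr _*_ (con K.1#) xs) ≡ foldr _*_ (con K.1#) (map (substitute θ) xs)
    ∏-substitute θ []       = ≡.refl
    ∏-substitute θ (x ∷ xs) = ≡.cong (_ *_) (∏-substitute θ xs)

    ∑-map : (f : A → B) (F : B → Poly n) → ∀ xs → E.∑ n (map f xs) F ≡ E.∑ n xs (F ∘ f)
    ∑-map f F xs = ≡.cong (foldr _+_ (con K.0#)) (≡.sym (Listₚ.map-∘ xs))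

    ^-substitute : (θ : Fin m → Poly n) → ∀ k f →
      substitute θ (E._^_ m f k) ≡ E._^_ n (substitute θ f) k
    ^-substitute θ zero    f = ≡.refl
    ^-substitute θ (suc k) f = ≡.cong (_ *_) (^-substitute θ k f)

    ∑-degree : ∀ {d} (F : A → Poly n) {xs} → All (λ x → termDegree (F x) ≤ d) xs →
               termDegree (E.∑ n xs F) ≤ d
    ∑-degree F []       = z≤n
    ∑-degree F (p ∷ ps) = ℕₚ.⊔-lub p (∑-degree F ps)

    ProductDegree : ℕ → List (Poly n) → Set
    ProductDegree k xs = termDegree (foldr _*_ (con K.1#) xs) ≤ k

    Linear : List (Poly n) → Set c
    Linear = All (λ f → termDegree f ≤ 1)

    multichoose-degree : ∀ k {xs : List (Poly n)} → Linear xs →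
                         All (ProductDegree k) (multichoose k xs)
    multichoose-degree zero    ps       = z≤n ∷ []
    multichoose-degree (suc k) []       = []
    multichoose-degree (suc k) (p ∷ ps) = Allₚ.++⁺
      (Allₚ.map⁺ (All.map (ℕₚ.+-mono-≤ p) (multichoose-degree k (p ∷ ps))))
      (multichoose-degree (suc k) ps)

    ^-degree : ∀ k {f : Poly n} → termDegree f ≤ 1 → termDegree (E._^_ n f k) ≤ k
    ^-degree zero    p = z≤n
    ^-degree (suc k) p = ℕₚ.+-mono-≤ p (^-degree k p)

    vars-linear : ∀ n → Linear (vars n)
    vars-linear n = Allₚ.tabulate⁺ (λ i → ℕₚ.≤-refl)

    module _
      (F : ∀ n → List (Poly n) → Poly n)
      (natural : ∀ {m n} (θ : Fin m → Poly n) xs → substitute θ (F m xs) ≡ F n (map (substitute θ) xs))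
      (perm : ∀ n {xs ys} → xs ↭ ys → F n xs ≋ F n ys)
      (drop : ∀ n xs → F n (con K.0# ∷ xs) ≋ F n xs)
      (d : ℕ) (degree : ∀ n {xs} → Linear xs → termDegree (F n xs) ≤ d)
      where

      private
        P≡ : ∀ {f g : Poly n} → f ≡ g → f ≋ g
        P≡ ≡.refl = ≋-refl

      fromVariables : Λ
      fromVariables = record
        { poly      = λ n → F n (vars n)
        ; symmetric = λ n σ → ≋-trans (P≡ (natural _ (vars n)))
            (≋-trans (P≡ (≡.cong (F n) (Listₚ.map-tabulate var _))) (perm n (tabulate-permute var σ)))
        ; stable    = λ n → ≋-trans (P≡ (natural _ (vars (suc n))))
            (≋-trans (P≡ (≡.cong (λ xs → F n (con K.0# ∷ xs)) (Listₚ.map-tabulate (var ∘ suc) _)))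
              (drop n (vars n)))
        ; bounded   = d , λ n → F n (vars n) , ≋-refl , degree n (vars-linear n)
        }

    complete-natural : ∀ k (θ : Fin m → Poly n) xs →
      substitute θ (E.complete m k xs) ≡ E.complete n k (map (substitute θ) xs)
    complete-natural k θ xs = ≡.trans (∑-substitute θ (∏-substitute θ) (multichoose k xs))
      (≡.trans (≡.sym (∑-map _ _ (multichoose k xs)))
        (≡.cong (λ u → E.∑ _ u (foldr _*_ (con K.1#))) (≡.sym (multichoose-map _ k xs))))

    powerSum-natural : ∀ k (θ : Fin m → Poly n) xs →
      substitute θ (E.powerSum m k xs) ≡ E.powerSum n k (map (substitute θ) xs)
    powerSum-natural k θ xs =
      ≡.trans (∑-substitute θ (^-substitute θ k) xs) (≡.sym (∑-map _ _ xs))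

  h : ℕ → Λ
  h k = fromVariables (λ n → E.complete n k) (complete-natural k)
          (λ n p → E.complete-↭ n p k) (λ n → E.complete-0 n k)
          k (λ n l → ∑-degree _ (multichoose-degree k l))

  p : (k : ℕ) .{{_ : NonZero k}} → Λ
  p k = fromVariables (λ n → E.powerSum n k) (powerSum-natural k)
          (λ n q → E.powerSum-↭ n q k) (λ n → E.powerSum-0 n k)
          k (λ n l → ∑-degree _ (All.map (^-degree k) l))

  Point : Set c
  Point = ∃ λ d → Vector K.Carrier d × Vector K.Carrier d

  -- The K-algebra homomorphism f ↦ f(x;y). Over a field of characteristic
  -- zero Λ is freely generated by the p_k, so it exists and is unique.
  record Evaluation (pt : Point) : Set (c ⊔ ℓ) where
    open OverRing K
    open RingMorphisms (CommutativeRing.rawRing ΛRing) K.rawRing using (IsRingHomomorphism)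
    private
      x = proj₁ (proj₂ pt)
      y = proj₂ (proj₂ pt)
    field
      ⟦_⟧                : Λ → K.Carrier
      isRingHomomorphism : IsRingHomomorphism ⟦_⟧
      ⟦const⟧            : ∀ k → ⟦ const k ⟧ K.≈ k
      ⟦p⟧                : ∀ k .{{_ : NonZero k}} →
        ⟦ p k ⟧ K.≈ sum (λ i → x i ^ k) K.+ (K.- K.1#) ^ pred k K.* sum (λ j → y j ^ k)

-- Rows, columns and boxes are numbered from 1.
record YoungDiagram : Set where
  field
    rows       : List ℕ
    decreasing : Linked _≥_ rows
    positive   : All (0 <_) rows

len : YoungDiagram → ℕ
len μ = length (YoungDiagram.rows μ)

-- the i-th part, with 0 beyond the end of the list; the index 0 is never used
part : List ℕ → ℕ → ℕ
part _        zero          = 0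
part []       (suc i)       = 0
part (r ∷ rs) (suc zero)    = r
part (r ∷ rs) (suc (suc i)) = part rs (suc i)

row : YoungDiagram → ℕ → ℕ
row μ = part (YoungDiagram.rows μ)

-- μ'_j = #{ i ∣ μ_i ≥ j }
col : YoungDiagram → ℕ → ℕ
col μ j = length (filter (j ℕₚ.≤?_) (YoungDiagram.rows μ))

boxes : YoungDiagram → List (ℕ × ℕ)
boxes μ = concatMap (λ i → map (i ,_) [1⋯ row μ i ]) [1⋯ len μ ]

diagonalLength : YoungDiagram → ℕ
diagonalLength μ = length (filter (λ i → i ℕₚ.≤? row μ i) [1⋯ len μ ])

frobeniusP frobeniusQ : YoungDiagram → ℕ → ℤ
frobeniusP μ i = row μ i ⊖ i
frobeniusQ μ i = col μ i ⊖ i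

module Multiparameter (K : CommutativeRing c ℓ) where

  private
    module K = CommutativeRing K
    module K′ = OverRing K
  open SymmetricFunctions K public

  Sequence : Set c
  Sequence = ℤ → K.Carrier

  τ : ℤ → Sequence → Sequence
  τ r a i = a (i ℤ.+ r)

  dual : Sequence → Sequence
  dual a i = K.- a (1ℤ ℤ.- i)

  -- h_{k;a}
  multiH : ℤ → Sequence → Λ
  multiH (+ zero)      a = const K.1#
  multiH (+ suc k-1)   a = ∑ [1⋯ k ] λ i →
    const ((K.- K.1#) K′.^ (k ∸ i) K.* K′.elementary (k ∸ i) (map (a ∘ +_) [1⋯ k-1 ])) * h i
    where
    k = suc k-1
    open OverRing ΛRing using (∑)
    open CommutativeRing ΛRing using (_*_)
  multiH -[1+ _ ]      a = const K.0#

  -- s_{μ;a}, computed from the N × N determinant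
  multiSchur : ℕ → YoungDiagram → Sequence → Λ
  multiSchur N μ a = det {n = N} λ r s →
    let i = suc (toℕ r) ; j = suc (toℕ s)
    in multiH (row μ i ⊖ i ℤ.+ + j) (τ (1ℤ ℤ.- + j) a)
    where open OverRing ΛRing using (det)

  -- (x(μ);y(μ))
  point : Sequence → YoungDiagram → Point
  point a μ with YoungDiagram.rows μ
  ... | []    = 1 , (λ _ → K.0#) , (λ _ → K.0#)
  ... | _ ∷ _ = diagonalLength μ
              , (λ i → a (frobeniusP μ (suc (toℕ i)) ℤ.+ 1ℤ))
              , (λ i → dual a (frobeniusQ μ (suc (toℕ i)) ℤ.+ 1ℤ))

module OverField (K : HeytingField c ℓ₁ ℓ₂) where

  open HeytingField K public using (Carrier; _≈_; _+_; _-_; 0#)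
  open OverRing (fieldRing K) public using (∏)
  open Multiparameter (fieldRing K) public
  open Evaluation public using (⟦_⟧)

{-# OPTIONS --safe #-}
module Submission where

-- Let H(t) be the value of Σ h_k t^k at (x(μ);y(μ)); by Newton's identities
-- H(t) = ∏ (1 + y_j t) / ∏ (1 - x_i t). Put b_i = a_{μ_i - i + 1} and
-- γ_l = a_{l - μ'_l}. Walking along the boundary of μ from its lower left end,
--   ∏_{l ≤ c} (1 - γ_l t) = H(t) ∏_{k ≤ i} (1 - b_k t) ∏_{l ≤ c - i} (1 - a_l t)
-- at every boundary point (i,c), and the point on the diagonal identifies H(t).
-- Taking c = μ_i and u = 1/t, the (i,j) entry of the determinant becomes the residue of
--   ∏_{l < j} (u - a_{1-l}) ∏_{l ≤ μ_i} (u - γ_l) / ∏_{k ≤ i} (u - b_k).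
-- Column operations replace u - a_{1-l} by u - b_l. The fraction is then a polynomial
-- for i < j, and its residue for i = j is ∏_{l ≤ μ_i} (b_i - γ_l).

open import Defs
open import Algebra.Apartness.Bundles using (HeytingField)
open import Algebra.Bundles using (CommutativeRing; Semiring)
import Algebra.Definitions.RawSemiring as RawSemiringDefinitions
open import Algebra.Morphism.Structures using (module RingMorphisms)
import Algebra.Properties.Group as GroupProperties
import Algebra.Properties.Ring as RingProperties
import Algebra.Solver.Ring.NaturalCoefficients.Default as NaturalSolver
open import Data.Fin.Base as Fin using (Fin; toℕ; punchIn)
import Data.Fin.Properties as Finₚ
open import Data.Integer.Base as ℤ using (ℤ; +_; -[1+_]; 1ℤ; _⊖_)
import Data.Integer.Properties as ℤₚ
import Data.Integer.Tactic.RingSolver as ℤ-Solver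
open import Data.List.Base using (List; []; _∷_; _++_; _∷ʳ_; map; foldr; length; filter; applyUpTo; tabulate; concatMap)
import Data.List.Properties as Listₚ
open import Data.List.Relation.Binary.Pointwise as Pointwise using (Pointwise; []; _∷_)
open import Data.List.Relation.Unary.Linked as Linked using (Linked; []; [-]; _∷_)
open import Data.Nat.Base as ℕ using (ℕ; zero; suc; _≤_; _<_; _≥_; z≤n; s≤s; _∸_)
import Data.Nat.Properties as ℕₚ
open import Data.Product.Base using (_×_; _,_; proj₁; proj₂)
open import Data.Sum.Base using (inj₁; inj₂)
open import Function.Base using (_∘_; _$_)
open import Level using (Level; _⊔_)
open import Relation.Binary.PropositionalEquality as ≡ using (_≡_; _≢_)
import Relation.Binary.Reasoning.Setoid as SetoidReasoning
open import Relation.Nullary.Decidable.Core using (yes; no)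
open import Relation.Nullary.Negation using (¬_; contradiction)
open import Relation.Unary using (Pred; Decidable)

-- An `Evaluation` prescribes values only on the `p k`. The values of h_k come from k h_k = Σ p_i
-- h_{k-i}, an identity in `Λ` that every homomorphism carries to `K`; there it is a recursion,
-- because positive integers can be cancelled in characteristic zero. The walk meets points with c <
-- i. Reading the product of the 1 - a_l t as a quotient there lets all boundary points, and all
-- matrix entries including those with μ_i < i, obey one formula. The replacement of u - a_{1-l} by
-- u - b_l is done one row at a time. One round trades the last factor u - s_j of every column but
-- the first for u - b_0. As u - b_0 is in each denominator, this clears the first row except for
-- its first entry, and the remaining minor is a matrix of the same form with the rows shifted by
-- one.

private
  variable
    c ℓ ℓ₁ ℓ₂ : Level

-- Power series under multiplication and division by linear factors.

module PowerSeries (R : CommutativeRing c ℓ) where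

  open CommutativeRing R hiding (zero)
  open OverRing R
  open RawSemiringDefinitions (Semiring.rawSemiring semiring) using () renaming (_×_ to _×ᴿ_)
  open RingProperties ring using (-‿distribˡ-*; -‿+-comm; -0#≈0#; -1*x≈-x)
  open NaturalSolver commutativeSemiring using (solve; _:=_; _:+_; _:*_; con)
  open SetoidReasoning setoid

  Series : Set c
  Series = ℕ → Carrier

  infix 4 _≗_
  _≗_ : Series → Series → Set ℓ
  F ≗ G = ∀ k → F k ≈ G k

  one : Series
  one zero    = 1#
  one (suc k) = 0#

  -- (1 - y t) F(t)
  mul : Carrier → Series → Series
  mul y F zero    = F zero
  mul y F (suc k) = F (suc k) + - y * F k

  -- F(t) / (1 - x t)
  div : Carrier → Series → Series
  div x F zero    = F zero
  div x F (suc k) = F (suc k) + x * div x F k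

  mul* div* : List Carrier → Series → Series
  mul* ys F = foldr mul F ys
  div* xs F = foldr div F xs

  mul-cong : ∀ {x y F G} → x ≈ y → F ≗ G → mul x F ≗ mul y G
  mul-cong p q zero    = q zero
  mul-cong p q (suc k) = +-cong (q (suc k)) (*-cong (-‿cong p) (q k))

  div-cong : ∀ {x y F G} → x ≈ y → F ≗ G → div x F ≗ div y G
  div-cong p q zero    = q zero
  div-cong p q (suc k) = +-cong (q (suc k)) (*-cong p (div-cong p q k))

  mul*-cong : ∀ ys {F G} → F ≗ G → mul* ys F ≗ mul* ys G
  mul*-cong []       q = q
  mul*-cong (y ∷ ys) q = mul-cong refl (mul*-cong ys q)

  div*-cong : ∀ xs {F G} → F ≗ G → div* xs F ≗ div* xs G
  div*-cong []       q = q
  div*-cong (x ∷ xs) q = div-cong refl (div*-cong xs q)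

  mul-comm : ∀ x y F → mul x (mul y F) ≗ mul y (mul x F)
  mul-comm x y F zero          = refl
  mul-comm x y F (suc zero)    = solve 4 (λ x y a b → (a :+ y :* b) :+ x :* b := (a :+ x :* b) :+ y :* b) refl
    (- x) (- y) (F 1) (F 0)
  mul-comm x y F (suc (suc k)) =
    solve 5 (λ x y a b c → (a :+ y :* b) :+ x :* (b :+ y :* c) := (a :+ x :* b) :+ y :* (b :+ x :* c)) refl
    (- x) (- y) (F (suc (suc k))) (F (suc k)) (F k)

  cancel-+ : ∀ u x v → (u + x * v) + - x * v ≈ u
  cancel-+ u x v = begin
    (u + x * v) + - x * v ≈⟨ +-assoc _ _ _ ⟩
    u + (x * v + - x * v) ≈⟨ +-congˡ (distribʳ v x (- x)) ⟨
    u + (x + - x) * v     ≈⟨ +-congˡ (*-congʳ (-‿inverseʳ x)) ⟩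
    u + 0# * v            ≈⟨ +-congˡ (zeroˡ v) ⟩
    u + 0#                ≈⟨ +-identityʳ u ⟩
    u                     ∎

  mul-div : ∀ x F → mul x (div x F) ≗ F
  mul-div x F zero    = refl
  mul-div x F (suc k) = cancel-+ (F (suc k)) x (div x F k)

  div-mul : ∀ x F → div x (mul x F) ≗ F
  div-mul x F zero    = refl
  div-mul x F (suc k) = begin
    (F (suc k) + - x * F k) + x * div x (mul x F) k ≈⟨ +-congˡ (*-congˡ (div-mul x F k)) ⟩
    (F (suc k) + - x * F k) + x * F k
      ≈⟨ solve 4 (λ a x y b → (a :+ y :* b) :+ x :* b := (a :+ x :* b) :+ y :* b) refl _ x (- x) (F k) ⟩
    (F (suc k) + x * F k) + - x * F k               ≈⟨ cancel-+ (F (suc k)) x (F k) ⟩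
    F (suc k)                                       ∎

  -- Since `div x` is the inverse of `mul x`, it commutes with everything that `mul x` commutes
  -- with.
  mul-div-comm : ∀ y x F → mul y (div x F) ≗ div x (mul y F)
  mul-div-comm y x F k = begin
    mul y (div x F) k                 ≈⟨ div-mul x (mul y (div x F)) k ⟨
    div x (mul x (mul y (div x F))) k ≈⟨ div-cong refl (mul-comm x y (div x F)) k ⟩
    div x (mul y (mul x (div x F))) k ≈⟨ div-cong refl (mul-cong refl (mul-div x F)) k ⟩
    div x (mul y F) k                 ∎

  mul*-mul : ∀ ys y F → mul* ys (mul y F) ≗ mul y (mul* ys F)
  mul*-mul []       y F k = refl
  mul*-mul (z ∷ ys) y F k =
    trans (mul-cong refl (mul*-mul ys y F) k) (mul-comm z y (mul* ys F) k)

  mul*-div : ∀ ys x F → mul* ys (div x F) ≗ div x (mul* ys F)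
  mul*-div []       x F k = refl
  mul*-div (y ∷ ys) x F k =
    trans (mul-cong refl (mul*-div ys x F) k) (mul-div-comm y x (mul* ys F) k)

  div*-mul : ∀ xs y F → div* xs (mul y F) ≗ mul y (div* xs F)
  div*-mul []       y F k = refl
  div*-mul (x ∷ xs) y F k =
    trans (div-cong refl (div*-mul xs y F) k) (sym (mul-div-comm y x (div* xs F) k))

  mul*-mul* : ∀ xs ys F → mul* xs (mul* ys F) ≗ mul* ys (mul* xs F)
  mul*-mul* []       ys F k = refl
  mul*-mul* (x ∷ xs) ys F k =
    trans (mul-cong refl (mul*-mul* xs ys F) k) (sym (mul*-mul ys x (mul* xs F) k))

  mul*-div* : ∀ xs F → mul* xs (div* xs F) ≗ F
  mul*-div* []       F k = refl
  mul*-div* (x ∷ xs) F k = begin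
    mul x (mul* xs (div x (div* xs F))) k ≈⟨ mul-cong refl (mul*-div xs x (div* xs F)) k ⟩
    mul x (div x (mul* xs (div* xs F))) k ≈⟨ mul-div x _ k ⟩
    mul* xs (div* xs F) k                 ≈⟨ mul*-div* xs F k ⟩
    F k                                   ∎

  div*-mul* : ∀ xs F → div* xs (mul* xs F) ≗ F
  div*-mul* []       F k = refl
  div*-mul* (x ∷ xs) F k = begin
    div x (div* xs (mul x (mul* xs F))) k ≈⟨ div-cong refl (div*-mul xs x (mul* xs F)) k ⟩
    div x (mul x (div* xs (mul* xs F))) k ≈⟨ div-mul x _ k ⟩
    div* xs (mul* xs F) k                 ≈⟨ div*-mul* xs F k ⟩
    F k                                   ∎

  mul*-∷ʳ : ∀ ys y F → mul* (ys ∷ʳ y) F ≗ mul y (mul* ys F)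
  mul*-∷ʳ ys y F k = trans (reflexive (≡.cong (_$ k) (Listₚ.foldr-∷ʳ mul F y ys))) (mul*-mul ys y F k)

  mul*-head : ∀ ys F → mul* ys F 0 ≈ F 0
  mul*-head []       F = refl
  mul*-head (y ∷ ys) F = mul*-head ys F

  div*-head : ∀ xs F → div* xs F 0 ≈ F 0
  div*-head []       F = refl
  div*-head (x ∷ xs) F = div*-head xs F

  mul*-degree : ∀ ys k → length ys < k → mul* ys one k ≈ 0#
  mul*-degree []       (suc k) _       = refl
  mul*-degree (y ∷ ys) (suc k) (s≤s l) = begin
    mul* ys one (suc k) + - y * mul* ys one k
      ≈⟨ +-cong (mul*-degree ys (suc k) (ℕₚ.m<n⇒m<1+n l)) (*-congˡ (mul*-degree ys k l)) ⟩
    0# + - y * 0# ≈⟨ +-identityˡ _ ⟩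
    - y * 0#      ≈⟨ zeroʳ _ ⟩
    0#            ∎

  -- t Q(t) F(t)
  conv : Series → Series → Series
  conv Q F zero    = 0#
  conv Q F (suc k) = Q zero * F k + conv (Q ∘ suc) F k

  conv-cong : ∀ {Q Q′ F F′} → Q ≗ Q′ → F ≗ F′ → conv Q F ≗ conv Q′ F′
  conv-cong p q zero    = refl
  conv-cong p q (suc k) = +-cong (*-cong (p zero) (q k)) (conv-cong (p ∘ suc) q k)

  conv-congʳ-< : ∀ Q {F F′} k → (∀ i → i < k → F i ≈ F′ i) → conv Q F k ≈ conv Q F′ k
  conv-congʳ-< Q zero    q = refl
  conv-congʳ-< Q (suc k) q =
    +-cong (*-congˡ (q k ℕₚ.≤-refl)) (conv-congʳ-< (Q ∘ suc) k (λ i l → q i (ℕₚ.m<n⇒m<1+n l)))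

  conv-+ : ∀ P Q F k → conv (λ i → P i + Q i) F k ≈ conv P F k + conv Q F k
  conv-+ P Q F zero    = sym (+-identityˡ 0#)
  conv-+ P Q F (suc k) = trans (+-congˡ (conv-+ (P ∘ suc) (Q ∘ suc) F k))
    (solve 5 (λ p q f a b → (p :+ q) :* f :+ (a :+ b) := (p :* f :+ a) :+ (q :* f :+ b)) refl _ _ _ _ _)

  conv-mul : ∀ Q y F → conv Q (mul y F) ≗ mul y (conv Q F)
  conv-mul Q y F zero          = refl
  conv-mul Q y F (suc zero)    =
    sym (trans (+-congˡ (zeroʳ _)) (+-identityʳ _))
  conv-mul Q y F (suc (suc k)) = trans (+-congˡ (conv-mul (Q ∘ suc) y F (suc k)))
    (solve 6 (λ q f y g a b → q :* (f :+ y :* g) :+ (a :+ y :* b) := (q :* f :+ a) :+ y :* (q :* g :+ b)) refl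
      _ _ _ _ _ _)

  conv-mul* : ∀ Q ys F → conv Q (mul* ys F) ≗ mul* ys (conv Q F)
  conv-mul* Q []       F k = refl
  conv-mul* Q (y ∷ ys) F k =
    trans (conv-mul Q y (mul* ys F) k) (mul-cong refl (conv-mul* Q ys F) k)

  conv-one : ∀ Q k → conv Q one (suc k) ≈ Q k
  conv-one Q zero    = trans (+-identityʳ _) (*-identityʳ _)
  conv-one Q (suc k) = trans (+-cong (zeroʳ _) (conv-one (Q ∘ suc) k)) (+-identityˡ _)

  -- The first series is u / (1 - x t). The factor `u` is kept general because the tail of a
  -- geometric series is geometric again, with `u * x` in place of `u`.
  conv-geometric : ∀ u x F k → conv (λ i → u * x ^ i) (mul x F) (suc k) ≈ u * F k
  conv-geometric u x F zero    = trans (+-identityʳ _) (*-congʳ (*-identityʳ u))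
  conv-geometric u x F (suc k) = begin
    u * 1# * (F (suc k) + - x * F k) + conv (λ i → u * (x * x ^ i)) (mul x F) (suc k)
      ≈⟨ +-congˡ (conv-cong (λ i → sym (*-assoc u x (x ^ i))) (λ _ → refl) (suc k)) ⟩
    u * 1# * (F (suc k) + - x * F k) + conv (λ i → u * x * x ^ i) (mul x F) (suc k)
      ≈⟨ +-congˡ (conv-geometric (u * x) x F k) ⟩
    u * 1# * (F (suc k) + - x * F k) + u * x * F k
      ≈⟨ +-congʳ (*-congʳ (*-identityʳ u)) ⟩
    u * (F (suc k) + - x * F k) + u * x * F k
      ≈⟨ solve 5 (λ u a y x b → u :* (a :+ y :* b) :+ u :* x :* b := u :* ((a :+ x :* b) :+ y :* b)) refl u (F (suc k)) (- x) x (F k) ⟩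
    u * ((F (suc k) + x * F k) + - x * F k)
      ≈⟨ *-congˡ (cancel-+ (F (suc k)) x (F k)) ⟩
    u * F (suc k) ∎

  -- Logarithmic derivatives and Newton's identities.

  nat : ℕ → Carrier
  nat n = n ×ᴿ 1#

  θ : Series → Series
  θ F k = nat k * F k

  t· : Series → Series
  t· F zero    = 0#
  t· F (suc k) = F k

  -- t F'(t) = t Q(t) F(t), so Q lists the power sums p₁, p₂, …
  Newton : Series → Series → Set ℓ
  Newton Q F = θ F ≗ conv Q F

  -- The product rule for t d/dt, which sends 1 - y t to - y t.
  θ-mul : ∀ y F k → θ (mul y F) k ≈ mul y (θ F) k + - y * t· F k
  θ-mul y F zero    = sym (trans (+-congˡ (zeroʳ _)) (+-identityʳ _))
  θ-mul y F (suc k) =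
    solve 4 (λ n a y b → (con 1 :+ n) :* (a :+ y :* b) := ((con 1 :+ n) :* a :+ y :* (n :* b)) :+ y :* b) (λ {_ _ _ _} → refl)
     (nat k) (F (suc k)) (- y) (F k)

  conv-power : ∀ x F k → conv (λ i → x ^ suc i) (mul x F) k ≈ x * t· F k
  conv-power x F zero    = sym (zeroʳ x)
  conv-power x F (suc k) = conv-geometric x x F k

  Newton-one : ∀ {Q} → (∀ i → Q i ≈ 0#) → Newton Q one
  Newton-one p zero    = zeroˡ 1#
  Newton-one {Q} p (suc k) = trans (zeroʳ _) (sym (trans (conv-one Q k) (p k)))

  -- The logarithmic derivative of 1 - y t, times t, is - y t / (1 - y t) = - Σ y^{i+1} t^{i+1};
  -- `conv-power` cancels the denominator against the factor in `mul y F`.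
  Newton-mul : ∀ {Q F} y → Newton Q F → Newton (λ i → Q i + - (y ^ suc i)) (mul y F)
  Newton-mul {Q} {F} y N k = begin
    θ (mul y F) k                                     ≈⟨ θ-mul y F k ⟩
    mul y (θ F) k + - y * t· F k                      ≈⟨ +-cong (mul-cong refl N k) (sym (-‿distribˡ-* _ _)) ⟩
    mul y (conv Q F) k + - (y * t· F k)               ≈⟨ +-cong (conv-mul Q y F k) (-‿cong (conv-power y F k)) ⟨
    conv Q (mul y F) k + - conv (λ i → y ^ suc i) (mul y F) k
      ≈⟨ +-congˡ (neg (λ i → y ^ suc i) (mul y F) k) ⟩
    conv Q (mul y F) k + conv (λ i → - (y ^ suc i)) (mul y F) k ≈⟨ conv-+ Q _ (mul y F) k ⟨
    conv (λ i → Q i + - (y ^ suc i)) (mul y F) k      ∎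
    where
    neg : ∀ P G k → - conv P G k ≈ conv (λ i → - P i) G k
    neg P G zero    = -0#≈0#
    neg P G (suc k) = trans (sym (-‿+-comm _ _)) (+-cong (-‿distribˡ-* _ _) (neg (P ∘ suc) G k))

  -- Multiplication by 1 - x t is injective by `div-mul`, so the two sides are compared after it.
  -- The product rule for `mul x G`, which is `F`, then replaces a derivative of the recursively
  -- defined quotient.
  Newton-div : ∀ {Q F} x → Newton Q F → Newton (λ i → x ^ suc i + Q i) (div x F)
  Newton-div {Q} {F} x N k = begin
    θ G k                     ≈⟨ div-mul x (θ G) k ⟨
    div x (mul x (θ G)) k     ≈⟨ div-cong refl core k ⟩
    div x (mul x (conv P G)) k ≈⟨ div-mul x (conv P G) k ⟩
    conv P G k                ∎
    where
    G = div x F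
    P : Series
    P i = x ^ suc i + Q i
    θF : ∀ k → θ F k ≈ mul x (θ G) k + - x * t· G k
    θF k = trans (*-congˡ (sym (mul-div x F k))) (θ-mul x G k)
    core : mul x (θ G) ≗ mul x (conv P G)
    core k = begin
      mul x (θ G) k                              ≈⟨ cancel-+ _ x (t· G k) ⟨
      (mul x (θ G) k + x * t· G k) + - x * t· G k
        ≈⟨ solve 3 (λ a b c → (a :+ b) :+ c := b :+ (a :+ c)) refl _ _ _ ⟩
      x * t· G k + (mul x (θ G) k + - x * t· G k) ≈⟨ +-congˡ (θF k) ⟨
      x * t· G k + θ F k                          ≈⟨ +-cong (sym (conv-power x G k)) (N k) ⟩
      conv (λ i → x ^ suc i) (mul x G) k + conv Q F k
        ≈⟨ +-congˡ (conv-cong {Q} (λ _ → refl) (λ i → sym (mul-div x F i)) k) ⟩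
      conv (λ i → x ^ suc i) (mul x G) k + conv Q (mul x G) k ≈⟨ conv-+ _ Q (mul x G) k ⟨
      conv P (mul x G) k                          ≈⟨ conv-mul P x G k ⟩
      mul x (conv P G) k                          ∎

  Newton-cong : ∀ {P Q F} → P ≗ Q → Newton P F → Newton Q F
  Newton-cong p N k = trans (N k) (conv-cong p (λ _ → refl) k)

  Newton-div* : ∀ {Q F} xs → Newton Q F → Newton (λ i → powerSum (suc i) xs + Q i) (div* xs F)
  Newton-div* []       N = Newton-cong (λ i → sym (+-identityˡ _)) N
  Newton-div* (x ∷ xs) N = Newton-cong (λ i → sym (+-assoc _ _ _)) (Newton-div x (Newton-div* xs N))

  Newton-mul* : ∀ {Q F} ys → Newton Q F → Newton (λ i → Q i + - powerSum (suc i) ys) (mul* ys F)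
  Newton-mul* []       N = Newton-cong (λ i → sym (trans (+-congˡ -0#≈0#) (+-identityʳ _))) N
  Newton-mul* (y ∷ ys) N = Newton-cong (λ i → trans (+-assoc _ _ _)
      (+-congˡ (trans (-‿+-comm _ _) (-‿cong (+-comm _ _))))) (Newton-mul y (Newton-mul* ys N))

  -- Coefficient k + 1 of `conv Q F` involves only coefficients of F up to k, so the equation is a
  -- recursion as soon as k + 1 can be cancelled. The bound `n` in `upTo` makes the strong induction
  -- structural.
  Newton-unique : (∀ k {x y} → nat (suc k) * x ≈ nat (suc k) * y → x ≈ y) →
                  ∀ {Q F G} → Newton Q F → Newton Q G → F 0 ≈ G 0 → F ≗ G
  Newton-unique cancel {Q} {F} {G} M N F₀≈G₀ k = upTo (suc k) k ℕₚ.≤-refl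
    where
    upTo : ∀ n i → i < n → F i ≈ G i
    upTo (suc n) zero    _       = F₀≈G₀
    upTo (suc n) (suc i) (s≤s l) = cancel i (begin
      θ F (suc i)      ≈⟨ M (suc i) ⟩
      conv Q F (suc i) ≈⟨ conv-congʳ-< Q (suc i) (λ j j≤i → upTo n j (ℕₚ.<-≤-trans j≤i l)) ⟩
      conv Q G (suc i) ≈⟨ N (suc i) ⟨
      θ G (suc i)      ∎)

  -- Generating series of the complete and elementary polynomials.

  complete-series : ∀ xs → (λ k → complete k xs) ≗ div* xs one
  complete-series []       zero    = +-identityʳ 1#
  complete-series []       (suc k) = refl
  complete-series (x ∷ xs) zero    = complete-series xs zero
  complete-series (x ∷ xs) (suc k) = begin
    complete (suc k) (x ∷ xs)                     ≈⟨ complete-step k x xs ⟩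
    x * complete k (x ∷ xs) + complete (suc k) xs ≈⟨ +-comm _ _ ⟩
    complete (suc k) xs + x * complete k (x ∷ xs)
      ≈⟨ +-cong (complete-series xs (suc k)) (*-congˡ (complete-series (x ∷ xs) k)) ⟩
    div* (x ∷ xs) one (suc k)                     ∎

  -- No integer is cancelled here, so this is available over every commutative ring, in particular
  -- over the polynomial rings that define `Λ`.
  Newton-complete : ∀ xs → Newton (λ i → powerSum (suc i) xs) (λ k → complete k xs)
  Newton-complete xs k = begin
    nat k * complete k xs             ≈⟨ *-congˡ (complete-series xs k) ⟩
    θ (div* xs one) k                 ≈⟨ Newton-cong (λ i → +-identityʳ _) (Newton-div* xs (Newton-one {λ _ → 0#} (λ _ → refl))) k ⟩
    conv _ (div* xs one) k            ≈⟨ conv-cong (λ _ → refl) (λ i → sym (complete-series xs i)) k ⟩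
    conv _ (λ k → complete k xs) k    ∎

  ∑-products-∷ : ∀ x (us vs : List (List Carrier)) →
    ∑ (map (x ∷_) us ++ vs) (foldr _*_ 1#) ≈ x * ∑ us (foldr _*_ 1#) + ∑ vs (foldr _*_ 1#)
  ∑-products-∷ x []       vs = sym (trans (+-congʳ (zeroʳ x)) (+-identityˡ _))
  ∑-products-∷ x (u ∷ us) vs = trans (+-congˡ (∑-products-∷ x us vs))
    (solve 4 (λ x p q r → x :* p :+ (x :* q :+ r) := x :* (p :+ q) :+ r) refl _ _ _ _)

  elementary-series : ∀ ys → (λ k → (- 1#) ^ k * elementary k ys) ≗ mul* ys one
  elementary-series []       zero    = trans (*-identityˡ _) (+-identityʳ 1#)
  elementary-series []       (suc k) = zeroʳ _
  elementary-series (y ∷ ys) zero    = elementary-series ys zero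
  elementary-series (y ∷ ys) (suc k) = begin
    - 1# * (- 1#) ^ k * elementary (suc k) (y ∷ ys)
      ≈⟨ *-congˡ (∑-products-∷ y (choose k ys) (choose (suc k) ys)) ⟩
    - 1# * (- 1#) ^ k * (y * elementary k ys + elementary (suc k) ys)
      ≈⟨ solve 5 (λ m p y e f → m :* p :* (y :* e :+ f) := m :* p :* f :+ (m :* y) :* (p :* e)) refl _ _ _ _ _ ⟩
    (- 1#) ^ suc k * elementary (suc k) ys + - 1# * y * ((- 1#) ^ k * elementary k ys)
      ≈⟨ +-cong (elementary-series ys (suc k)) (*-cong (-1*x≈-x y) (elementary-series ys k)) ⟩
    mul* (y ∷ ys) one (suc k) ∎

-- Determinants as alternating functions of a list of columns.

module Determinants (R : CommutativeRing c ℓ) where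

  open CommutativeRing R hiding (zero)
  open OverRing R
  open RingProperties ring using (-‿distribʳ-*; -0#≈0#; -‿+-comm; -1*x≈-x)
  open NaturalSolver commutativeSemiring using (solve; _:=_; _:+_; _:*_)
  open SetoidReasoning setoid

  Column : Set c
  Column = ℕ → Carrier

  infix 4 _≋_
  _≋_ : Column → Column → Set ℓ
  u ≋ v = ∀ i → u i ≈ v i

  _+[_]_ : Column → Carrier → Column → Column
  (u +[ κ ] v) i = u i + κ * v i

  -- Vanishing is asked for equal neighbours only: this is all that `shear` needs, and it is easily
  -- seen to survive `contract`. Lists of unrestricted length allow leading columns to be fixed one
  -- by one, as in `Alternating-∷`.
  record Alternating (φ : List Column → Carrier) : Set (c ⊔ ℓ) where
    field
      cong        : ∀ {us vs} → Pointwise _≋_ us vs → φ us ≈ φ vs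
      linear      : ∀ us u κ v ws → φ (us ++ (u +[ κ ] v) ∷ ws) ≈ φ (us ++ u ∷ ws) + κ * φ (us ++ v ∷ ws)
      alternating : ∀ us v ws → φ (us ++ v ∷ v ∷ ws) ≈ 0#

  open Alternating

  Alternating-∷ : ∀ {φ} u → Alternating φ → Alternating (φ ∘ (u ∷_))
  Alternating-∷ u A = record
    { cong        = λ p → cong A ((λ _ → refl) ∷ p)
    ; linear      = λ us → linear A (u ∷ us)
    ; alternating = λ us → alternating A (u ∷ us)
    }

  -- Σⱼ (-1)ʲ f(vⱼ) φ(v₀, …, v̂ⱼ, …)
  contract : (Column → Carrier) → (List Column → Carrier) → List Column → Carrier
  contract f φ []       = 0#
  contract f φ (v ∷ vs) = f v * φ vs + - contract f (φ ∘ (v ∷_)) vs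

  contract-cong : ∀ {f} → (∀ {u v} → u ≋ v → f u ≈ f v) → ∀ {φ ψ} →
    (∀ {us vs} → Pointwise _≋_ us vs → φ us ≈ ψ vs) →
    ∀ {us vs} → Pointwise _≋_ us vs → contract f φ us ≈ contract f ψ vs
  contract-cong p q []       = refl
  contract-cong p q (e ∷ es) =
    +-cong (*-cong (p e) (q es)) (-‿cong (contract-cong p (λ d → q (e ∷ d)) es))

  contract-linear : ∀ f {φ ψ χ} κ → (∀ us → φ us ≈ ψ us + κ * χ us) →
    ∀ us → contract f φ us ≈ contract f ψ us + κ * contract f χ us
  contract-linear f κ q []       = sym (trans (+-congˡ (zeroʳ κ)) (+-identityˡ 0#))
  contract-linear f {φ} {ψ} {χ} κ q (u ∷ us) = begin
    f u * φ us + - contract f (φ ∘ (u ∷_)) us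
      ≈⟨ +-cong (*-congˡ (q us)) (-‿cong (contract-linear f κ (λ vs → q (u ∷ vs)) us)) ⟩
    f u * (ψ us + κ * χ us) + - (a + κ * b)
      ≈⟨ +-congˡ (trans (sym (-‿+-comm a (κ * b))) (+-congˡ (-‿distribʳ-* κ b))) ⟩
    f u * (ψ us + κ * χ us) + (- a + κ * - b)
      ≈⟨ solve 6 (λ f p k x a b → f :* (p :+ k :* x) :+ (a :+ k :* b) := (f :* p :+ a) :+ k :* (f :* x :+ b)) refl _ _ _ _ _ _ ⟩
    (f u * ψ us + - a) + κ * (f u * χ us + - b) ∎
    where
    a = contract f (ψ ∘ (u ∷_)) us
    b = contract f (χ ∘ (u ∷_)) us

  contract-zero : ∀ f {φ} → (∀ us → φ us ≈ 0#) → ∀ us → contract f φ us ≈ 0#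
  contract-zero f q []       = refl
  contract-zero f q (u ∷ us) =
    trans (+-cong (trans (*-congˡ (q us)) (zeroʳ _)) (trans (-‿cong (contract-zero f (λ vs → q (u ∷ vs)) us)) -0#≈0#))
      (+-identityˡ 0#)

  contract-kernel : ∀ f φ {us} → Pointwise (λ u _ → f u ≈ 0#) us us → contract f φ us ≈ 0#
  contract-kernel f φ []       = refl
  contract-kernel f φ (p ∷ ps) =
    trans (+-cong (trans (*-congʳ p) (zeroˡ _)) (trans (-‿cong (contract-kernel f _ ps)) -0#≈0#))
      (+-identityˡ 0#)

  Alternating-contract : ∀ {φ} i → Alternating φ → Alternating (contract (λ v → v i) φ)
  Alternating-contract i A = record
    { cong        = contract-cong (λ p → p i) (cong A)
    ; linear      = lin A
    ; alternating = alt A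
    }
    where
    f : Column → Carrier
    f v = v i
    lin : ∀ {φ} → Alternating φ → ∀ us u κ v ws →
      contract f φ (us ++ (u +[ κ ] v) ∷ ws) ≈ contract f φ (us ++ u ∷ ws) + κ * contract f φ (us ++ v ∷ ws)
    lin {φ} A [] u κ v ws = begin
      (f u + κ * f v) * φ ws + - contract f (φ ∘ ((u +[ κ ] v) ∷_)) ws
        ≈⟨ +-congˡ (-‿cong (contract-linear f κ (λ xs → linear A [] u κ v xs) ws)) ⟩
      (f u + κ * f v) * φ ws + - (a + κ * b)
        ≈⟨ +-congˡ (trans (sym (-‿+-comm a (κ * b))) (+-congˡ (-‿distribʳ-* κ b))) ⟩
      (f u + κ * f v) * φ ws + (- a + κ * - b)
        ≈⟨ solve 6 (λ f p k x a b → (f :+ k :* x) :* p :+ (a :+ k :* b) := (f :* p :+ a) :+ k :* (x :* p :+ b)) refl _ _ _ _ _ _ ⟩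
      (f u * φ ws + - a) + κ * (f v * φ ws + - b) ∎
      where
      a = contract f (φ ∘ (u ∷_)) ws
      b = contract f (φ ∘ (v ∷_)) ws
    lin {φ} A (x ∷ us) u κ v ws = begin
      f x * φ (us ++ (u +[ κ ] v) ∷ ws) + - contract f (φ ∘ (x ∷_)) (us ++ (u +[ κ ] v) ∷ ws)
        ≈⟨ +-cong (*-congˡ (linear A us u κ v ws)) (-‿cong (lin (Alternating-∷ x A) us u κ v ws)) ⟩
      f x * (φ (us ++ u ∷ ws) + κ * φ (us ++ v ∷ ws)) + - (a + κ * b)
        ≈⟨ +-congˡ (trans (sym (-‿+-comm a (κ * b))) (+-congˡ (-‿distribʳ-* κ b))) ⟩
      f x * (φ (us ++ u ∷ ws) + κ * φ (us ++ v ∷ ws)) + (- a + κ * - b)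
        ≈⟨ solve 6 (λ f p k x a b → f :* (p :+ k :* x) :+ (a :+ k :* b) := (f :* p :+ a) :+ k :* (f :* x :+ b)) refl _ _ _ _ _ _ ⟩
      (f x * φ (us ++ u ∷ ws) + - a) + κ * (f x * φ (us ++ v ∷ ws) + - b) ∎
      where
      a = contract f (φ ∘ (x ∷_)) (us ++ u ∷ ws)
      b = contract f (φ ∘ (x ∷_)) (us ++ v ∷ ws)
    alt : ∀ {φ} → Alternating φ → ∀ us v ws → contract f φ (us ++ v ∷ v ∷ ws) ≈ 0#
    -- The two terms that remove one of the equal columns have opposite signs; every other term
    -- keeps both columns and vanishes.
    alt {φ} A [] v ws = begin
      p + - (p + - contract f (φ ∘ (λ xs → v ∷ v ∷ xs)) ws)
        ≈⟨ +-congˡ (-‿cong (+-congˡ (trans (-‿cong (contract-zero f (alternating A [] v) ws)) -0#≈0#))) ⟩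
      p + - (p + 0#) ≈⟨ +-congˡ (-‿cong (+-identityʳ p)) ⟩
      p + - p        ≈⟨ -‿inverseʳ p ⟩
      0#             ∎
      where p = f v * φ (v ∷ ws)
    alt {φ} A (x ∷ us) v ws = trans
      (+-cong (trans (*-congˡ (alternating A us v ws)) (zeroʳ _))
              (trans (-‿cong (alt (Alternating-∷ x A) us v ws)) -0#≈0#))
      (+-identityˡ 0#)

  shift : Column → Column
  shift v i = v (suc i)

  -- The value 0# on lists of the wrong length makes the laws of `Alternating` hold for all lists.
  detᶜ : ℕ → List Column → Carrier
  detᶜ zero    []      = 1#
  detᶜ zero    (_ ∷ _) = 0#
  detᶜ (suc n) vs      = contract (λ v → v 0) (detᶜ n ∘ map shift) vs

  Alternating-detᶜ : ∀ n → Alternating (detᶜ n)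
  Alternating-detᶜ zero    = record { cong = cong₀ ; linear = linear₀ ; alternating = alternating₀ }
    where
    cong₀ : ∀ {us vs} → Pointwise _≋_ us vs → detᶜ zero us ≈ detᶜ zero vs
    cong₀ []      = refl
    cong₀ (_ ∷ _) = refl
    0≈0+κ0 : ∀ κ → 0# ≈ 0# + κ * 0#
    0≈0+κ0 κ = sym (trans (+-congˡ (zeroʳ κ)) (+-identityˡ 0#))
    linear₀ : ∀ us u κ v ws →
      detᶜ zero (us ++ (u +[ κ ] v) ∷ ws) ≈ detᶜ zero (us ++ u ∷ ws) + κ * detᶜ zero (us ++ v ∷ ws)
    linear₀ []       u κ v ws = 0≈0+κ0 κ
    linear₀ (_ ∷ us) u κ v ws = 0≈0+κ0 κ
    alternating₀ : ∀ us v ws → detᶜ zero (us ++ v ∷ v ∷ ws) ≈ 0#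
    alternating₀ []       v ws = refl
    alternating₀ (_ ∷ us) v ws = refl
  Alternating-detᶜ (suc n) = Alternating-contract 0 record
    { cong        = λ p → cong D (Pointwise.map⁺ shift shift (Pointwise.map (λ e i → e (suc i)) p))
    ; linear      = λ us u κ v ws → begin
        detᶜ n (map shift (us ++ (u +[ κ ] v) ∷ ws))
          ≡⟨ ≡.cong (detᶜ n) (Listₚ.map-++ shift us _) ⟩
        detᶜ n (map shift us ++ (shift u +[ κ ] shift v) ∷ map shift ws)
          ≈⟨ linear D (map shift us) (shift u) κ (shift v) (map shift ws) ⟩
        detᶜ n (map shift us ++ shift u ∷ map shift ws) + κ * detᶜ n (map shift us ++ shift v ∷ map shift ws)
          ≡⟨ ≡.cong₂ (λ x y → detᶜ n x + κ * detᶜ n y) (Listₚ.map-++ shift us _) (Listₚ.map-++ shift us _) ⟨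
        detᶜ n (map shift (us ++ u ∷ ws)) + κ * detᶜ n (map shift (us ++ v ∷ ws)) ∎
    ; alternating = λ us v ws →
        trans (reflexive (≡.cong (detᶜ n) (Listₚ.map-++ shift us _)))
              (alternating D (map shift us) (shift v) (map shift ws))
    }
    where D = Alternating-detᶜ n

  sum-cong : ∀ {n} {f g : Fin n → Carrier} → (∀ i → f i ≈ g i) → sum f ≈ sum g
  sum-cong {zero}  p = refl
  sum-cong {suc n} p = +-cong (p Fin.zero) (sum-cong (p ∘ Fin.suc))

  sum-neg : ∀ {n} (f : Fin n → Carrier) → sum (λ i → - f i) ≈ - sum f
  sum-neg {zero}  f = sym -0#≈0#
  sum-neg {suc n} f = trans (+-congˡ (sum-neg (f ∘ Fin.suc))) (-‿+-comm _ _)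

  -- The nested minus signs of `contract` accumulate to the powers of - 1# used by `det`.
  contract-tabulate : ∀ f φ {n} (v : Fin (suc n) → Column) →
    contract f φ (tabulate v) ≈
    sum (λ j → (- 1#) ^ toℕ j * (f (v j) * φ (tabulate (v ∘ punchIn j))))
  contract-tabulate f φ {zero} v = +-cong (sym (*-identityˡ _)) -0#≈0#
  contract-tabulate f φ {suc n} v = +-cong (sym (*-identityˡ _)) (begin
    - contract f (φ ∘ (v Fin.zero ∷_)) (tabulate (v ∘ Fin.suc))
      ≈⟨ -‿cong (contract-tabulate f (φ ∘ (v Fin.zero ∷_)) (v ∘ Fin.suc)) ⟩
    - sum g
      ≈⟨ sum-neg g ⟨
    sum (λ j → - g j)
      ≈⟨ sum-cong {f = λ j → - g j} {g = λ j → (- 1#) ^ suc (toℕ j) * t j}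
           (λ j → trans (sym (-1*x≈-x _)) (sym (*-assoc _ _ _))) ⟩
    sum (λ j → (- 1#) ^ suc (toℕ j) * t j) ∎)
    where
    t : Fin (suc n) → Carrier
    t j = f (v (Fin.suc j)) * φ (v Fin.zero ∷ tabulate (v ∘ Fin.suc ∘ punchIn j))
    g : Fin (suc n) → Carrier
    g j = (- 1#) ^ toℕ j * t j

  det≈detᶜ : ∀ {n} (v : Fin n → Column) → det (λ r s → v s (toℕ r)) ≈ detᶜ n (tabulate v)
  det≈detᶜ {zero}  v = refl
  det≈detᶜ {suc n} v = begin
    sum (λ j → (- 1#) ^ toℕ j * (v j 0 * det (λ r s → v (punchIn j s) (suc (toℕ r)))))
      ≈⟨ sum-cong (λ j → *-congˡ {(- 1#) ^ toℕ j} (*-congˡ {v j 0} (trans (det≈detᶜ (shift ∘ v ∘ punchIn j))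
           (reflexive (≡.cong (detᶜ n) (≡.sym (Listₚ.map-tabulate (v ∘ punchIn j) shift))))))) ⟩
    sum (λ j → (- 1#) ^ toℕ j * (v j 0 * detᶜ n (map shift (tabulate (v ∘ punchIn j)))))
      ≈⟨ contract-tabulate (λ u → u 0) (detᶜ n ∘ map shift) v ⟨
    detᶜ (suc n) (tabulate v) ∎

  ∏< : (ℕ → Carrier) → ℕ → Carrier
  ∏< f n = foldr _*_ 1# (applyUpTo f n)

  ∏<-cong : ∀ {f g} n → (∀ i → i < n → f i ≈ g i) → ∏< f n ≈ ∏< g n
  ∏<-cong zero    p = refl
  ∏<-cong (suc n) p = *-cong (p 0 (s≤s z≤n)) (∏<-cong n (λ i l → p (suc i) (s≤s l)))

  -- The rightmost columns are changed first, so that each column receives a multiple of its still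
  -- unchanged predecessor, which alternation makes harmless.
  shear : ∀ n {φ} → Alternating φ → (v : ℕ → Column) (κ : ℕ → Carrier) →
    φ (v 0 ∷ applyUpTo (v ∘ suc) n) ≈ φ (v 0 ∷ applyUpTo (λ j → v (suc j) +[ κ j ] v j) n)
  shear zero        A v κ = refl
  shear (suc n) {φ} A v κ = begin
    φ (v 0 ∷ v 1 ∷ applyUpTo (v ∘ suc ∘ suc) n)
      ≈⟨ shear n (Alternating-∷ (v 0) A) (v ∘ suc) (κ ∘ suc) ⟩
    φ (v 0 ∷ v 1 ∷ ws)                            ≈⟨ +-identityʳ _ ⟨
    φ (v 0 ∷ v 1 ∷ ws) + 0#                       ≈⟨ +-congˡ (zeroʳ (κ 0)) ⟨
    φ (v 0 ∷ v 1 ∷ ws) + κ 0 * 0#                 ≈⟨ +-congˡ (*-congˡ (alternating A [] (v 0) ws)) ⟨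
    φ (v 0 ∷ v 1 ∷ ws) + κ 0 * φ (v 0 ∷ v 0 ∷ ws) ≈⟨ linear A (v 0 ∷ []) (v 1) (κ 0) (v 0) ws ⟨
    φ (v 0 ∷ (v 1 +[ κ 0 ] v 0) ∷ ws)             ∎
    where ws = applyUpTo (λ j → v (suc (suc j)) +[ κ (suc j) ] v (suc j)) n

  -- Subtracting from each column a multiple of its predecessor clears the first row.
  detᶜ-condense : ∀ n (v w : ℕ → Column) (κ : ℕ → Carrier) →
    (∀ j → v (suc j) 0 + κ j * v j 0 ≈ 0#) →
    (∀ i j → v (suc j) (suc i) + κ j * v j (suc i) ≈ w j i) →
    detᶜ (suc n) (applyUpTo v (suc n)) ≈ v 0 0 * detᶜ n (applyUpTo w n)
  detᶜ-condense n v w κ p q = begin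
    detᶜ (suc n) (v 0 ∷ applyUpTo (v ∘ suc) n)
      ≈⟨ shear n (Alternating-detᶜ (suc n)) v κ ⟩
    v 0 0 * detᶜ n (map shift us) + - contract _ (detᶜ n ∘ map shift ∘ (v 0 ∷_)) us
      ≈⟨ +-congˡ (trans (-‿cong (contract-kernel (λ u → u 0) _ (kernel n (λ j → v (suc j) +[ κ j ] v j) p))) -0#≈0#) ⟩
    v 0 0 * detᶜ n (map shift us) + 0#
      ≈⟨ +-identityʳ _ ⟩
    v 0 0 * detᶜ n (map shift us)
      ≈⟨ *-congˡ (cong (Alternating-detᶜ n) (minor n (λ j → v (suc j) +[ κ j ] v j) w (λ j i → q i j))) ⟩
    v 0 0 * detᶜ n (applyUpTo w n) ∎
    where
    us = applyUpTo (λ j → v (suc j) +[ κ j ] v j) n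
    kernel : ∀ n (u : ℕ → Column) → (∀ j → u j 0 ≈ 0#) →
             Pointwise (λ u _ → u 0 ≈ 0#) (applyUpTo u n) (applyUpTo u n)
    kernel zero    u p = []
    kernel (suc n) u p = p 0 ∷ kernel n (u ∘ suc) (p ∘ suc)
    minor : ∀ n (u w : ℕ → Column) → (∀ j → shift (u j) ≋ w j) →
            Pointwise _≋_ (map shift (applyUpTo u n)) (applyUpTo w n)
    minor zero    u w p = []
    minor (suc n) u w p = p 0 ∷ minor n (u ∘ suc) (w ∘ suc) (p ∘ suc)

-- The determinant of a matrix of residues.

module CoefficientMatrix (R : CommutativeRing c ℓ) where

  open CommutativeRing R hiding (zero)
  open OverRing R
  open PowerSeries R
  open Determinants R
  open NaturalSolver commutativeSemiring using (solve; _:=_; _:+_; _:*_)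
  open SetoidReasoning setoid

  coefficient : Series → ℤ → Carrier
  coefficient F (+ k)    = F k
  coefficient F -[1+ _ ] = 0#

  coefficient-cong : ∀ {F G} → F ≗ G → ∀ k → coefficient F k ≈ coefficient G k
  coefficient-cong p (+ k)    = p k
  coefficient-cong p -[1+ _ ] = refl

  -- (1 - s t) / (1 - b t) = 1 + (b - s) t / (1 - b t)
  coefficient-step : ∀ b s F m n →
    coefficient (div b (mul s F)) (suc n ⊖ m) ≈
    coefficient F (suc n ⊖ m) + (b + - s) * coefficient (div b F) (n ⊖ m)
  coefficient-step b s F m n = trans (coefficient-cong (λ k → sym (mul-div-comm s b F k)) (suc n ⊖ m)) (go m n)
    where
    G = div b F
    go : ∀ m n → coefficient (mul s G) (suc n ⊖ m) ≈
                 coefficient F (suc n ⊖ m) + (b + - s) * coefficient G (n ⊖ m)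
    go zero n = solve 4 (λ f b g s → (f :+ b :* g) :+ s :* g := f :+ (b :+ s) :* g) refl (F (suc n)) b (G n) (- s)
    go (suc zero) zero = sym (trans (+-congˡ (zeroʳ _)) (+-identityʳ _))
    go (suc (suc m)) zero = sym (trans (+-congˡ (zeroʳ _)) (+-identityʳ _))
    go (suc m) (suc n) rewrite ℤₚ.[1+m]⊖[1+n]≡m⊖n (suc n) m | ℤₚ.[1+m]⊖[1+n]≡m⊖n n m = go m n

  -- The remainder theorem: P(u) / (u - b) has residue P(b). Each factor splits as u - y = (u - b) +
  -- (b - y), and the first summand cancels the pole, leaving a polynomial without residue.
  residue-simple-pole : ∀ b ys → div b (mul* ys one) (length ys) ≈ foldr _*_ 1# (map (λ y → b + - y) ys)
  residue-simple-pole b []       = refl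
  residue-simple-pole b (y ∷ ys) = begin
    div b (mul y F) (suc (length ys))
      ≈⟨ coefficient-step b y F 0 (length ys) ⟩
    F (suc (length ys)) + (b + - y) * div b F (length ys)
      ≈⟨ +-cong (mul*-degree ys (suc (length ys)) ℕₚ.≤-refl) (*-congˡ (residue-simple-pole b ys)) ⟩
    0# + (b + - y) * foldr _*_ 1# (map (λ y → b + - y) ys)
      ≈⟨ +-identityˡ _ ⟩
    (b + - y) * foldr _*_ 1# (map (λ y → b + - y) ys) ∎
    where F = mul* ys one

  module _ (s γ : ℕ → Carrier) where

    -- Condensation drops the first row, which shifts `ρ` and `b`; they are therefore arguments,
    -- while `s` and `γ` stay fixed.
    entrySeries : (ρ : ℕ → ℕ) (b : ℕ → Carrier) → ℕ → ℕ → Series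
    entrySeries ρ b i j = div* (applyUpTo b (suc i)) (mul* (applyUpTo s j) (mul* (applyUpTo γ (ρ i)) one))

    -- The residue (the coefficient of 1/u, where u = 1/t) of
    -- ∏_{l < j} (u - s_l) ∏_{l < ρ_i} (u - γ_l) / ∏_{k ≤ i} (u - b_k).
    entry : (ρ : ℕ → ℕ) (b : ℕ → Carrier) → ℕ → ℕ → Carrier
    entry ρ b j i = coefficient (entrySeries ρ b i j) (ρ i ℕ.+ j ⊖ i)

    entrySeries-suc : ∀ ρ b i j → entrySeries ρ b i (suc j) ≗
      div (b 0) (mul (s j) (div* (applyUpTo (b ∘ suc) i) (mul* (applyUpTo s j) (mul* (applyUpTo γ (ρ i)) one))))
    entrySeries-suc ρ b i j = div-cong refl (λ k → trans
      (div*-cong (applyUpTo (b ∘ suc) i) (λ k → trans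
        (reflexive (≡.cong (λ z → mul* z F k) (≡.sym (Listₚ.applyUpTo-∷ʳ s j))))
        (mul*-∷ʳ (applyUpTo s j) (s j) F k)) k)
      (div*-mul (applyUpTo (b ∘ suc) i) (s j) _ k))
      where F = mul* (applyUpTo γ (ρ i)) one

    -- The split u - s_j = (u - b_0) + (b_0 - s_j): the first summand takes b_0 out of the
    -- denominator, the second gives a multiple of the preceding column.
    entry-suc : ∀ ρ b i j → entry ρ b (suc j) i ≈
      coefficient (div* (applyUpTo (b ∘ suc) i) (mul* (applyUpTo s j) (mul* (applyUpTo γ (ρ i)) one))) (suc (ρ i ℕ.+ j) ⊖ i)
      + (b 0 + - s j) * entry ρ b j i
    entry-suc ρ b i j rewrite ℕₚ.+-suc (ρ i) j =
      trans (coefficient-cong (entrySeries-suc ρ b i j) (suc (ρ i ℕ.+ j) ⊖ i))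
            (coefficient-step (b 0) (s j) _ i (ρ i ℕ.+ j))

    -- The loss of one denominator factor and the drop of the row number by one fit together in the
    -- coefficient index, so the minor is again a matrix of the form `entry` and the recursion
    -- closes.
    entry-condense : ∀ ρ b i j →
      entry ρ b (suc j) (suc i) + - (b 0 + - s j) * entry ρ b j (suc i) ≈ entry (ρ ∘ suc) (b ∘ suc) j i
    entry-condense ρ b i j = begin
      entry ρ b (suc j) (suc i) + - x * v ≈⟨ +-congʳ (entry-suc ρ b (suc i) j) ⟩
      (_ + x * v) + - x * v               ≈⟨ cancel-+ _ x v ⟩
      coefficient F (suc (ρ (suc i) ℕ.+ j) ⊖ suc i)
        ≡⟨ ≡.cong (coefficient F) (ℤₚ.[1+m]⊖[1+n]≡m⊖n (ρ (suc i) ℕ.+ j) i) ⟩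
      entry (ρ ∘ suc) (b ∘ suc) j i       ∎
      where
      x = b 0 + - s j
      v = entry ρ b j (suc i)
      F = entrySeries (ρ ∘ suc) (b ∘ suc) i j

    -- In the first row b_0 is the only denominator factor. What is left is a polynomial of degree
    -- at most `ρ 0 + j`, read off one place beyond that.
    entry-firstRow : ∀ ρ b j → entry ρ b (suc j) 0 + - (b 0 + - s j) * entry ρ b j 0 ≈ 0#
    entry-firstRow ρ b j = begin
      entry ρ b (suc j) 0 + - x * v ≈⟨ +-congʳ (entry-suc ρ b 0 j) ⟩
      (F (suc (ρ 0 ℕ.+ j)) + x * v) + - x * v ≈⟨ cancel-+ _ x v ⟩
      F (suc (ρ 0 ℕ.+ j)) ≡⟨ ≡.cong (λ z → z (suc (ρ 0 ℕ.+ j))) (Listₚ.foldr-++ mul one (applyUpTo s j) (applyUpTo γ (ρ 0))) ⟨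
      mul* ys one (suc (ρ 0 ℕ.+ j)) ≈⟨ mul*-degree ys _ (s≤s (ℕₚ.≤-reflexive degree)) ⟩
      0# ∎
      where
      x = b 0 + - s j
      v = entry ρ b j 0
      F = mul* (applyUpTo s j) (mul* (applyUpTo γ (ρ 0)) one)
      ys = applyUpTo s j ++ applyUpTo γ (ρ 0)
      degree : length ys ≡ ρ 0 ℕ.+ j
      degree = ≡.trans (Listₚ.length-++ (applyUpTo s j))
        (≡.trans (≡.cong₂ ℕ._+_ (Listₚ.length-applyUpTo s j) (Listₚ.length-applyUpTo γ (ρ 0))) (ℕₚ.+-comm j (ρ 0)))

    entry-corner : ∀ ρ b → entry ρ b 0 0 ≈ ∏< (λ l → b 0 + - γ l) (ρ 0)
    entry-corner ρ b = begin
      div (b 0) (mul* ys one) (ρ 0 ℕ.+ 0)    ≡⟨ ≡.cong (div (b 0) (mul* ys one)) degree ⟨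
      div (b 0) (mul* ys one) (length ys)    ≈⟨ residue-simple-pole (b 0) ys ⟩
      foldr _*_ 1# (map (λ y → b 0 + - y) ys) ≡⟨ ≡.cong (foldr _*_ 1#) (Listₚ.map-applyUpTo γ _ (ρ 0)) ⟩
      ∏< (λ l → b 0 + - γ l) (ρ 0)           ∎
      where
      ys = applyUpTo γ (ρ 0)
      degree : length ys ≡ ρ 0 ℕ.+ 0
      degree = ≡.trans (Listₚ.length-applyUpTo γ (ρ 0)) (≡.sym (ℕₚ.+-identityʳ (ρ 0)))

    detᶜ-entry : ∀ n ρ b → detᶜ n (applyUpTo (entry ρ b) n) ≈ ∏< (λ i → ∏< (λ l → b i + - γ l) (ρ i)) n
    detᶜ-entry zero    ρ b = refl
    detᶜ-entry (suc n) ρ b = trans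
      (detᶜ-condense n (entry ρ b) (entry (ρ ∘ suc) (b ∘ suc)) (λ j → - (b 0 + - s j))
        (entry-firstRow ρ b) (entry-condense ρ b))
      (*-cong (entry-corner ρ b) (detᶜ-entry n (ρ ∘ suc) (b ∘ suc)))

-- Newton's identities in the algebra of symmetric functions.

module NewtonIdentities (K : CommutativeRing c ℓ) where

  private
    module K = CommutativeRing K
    module KS = PowerSeries K
  open Polynomials K
  open SymmetricFunctions K
  open Λ
  private
    module ΛS = PowerSeries ΛRing
    module PS n = PowerSeries (polyRing n)

  con-nat : ∀ {n} k → con (KS.nat k) ≋ PS.nat n k
  con-nat zero    = ≋-refl
  con-nat (suc k) = ≋-trans (con-+ _ _) (+-cong ≋-refl (con-nat k))

  poly-conv : ∀ Q G k n → poly (ΛS.conv Q G k) n ≡ PS.conv n (λ i → poly (Q i) n) (λ i → poly (G i) n) k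
  poly-conv Q G zero    n = ≡.refl
  poly-conv Q G (suc k) n = ≡.cong (λ f → poly (Q 0) n * poly (G k) n + f) (poly-conv (Q ∘ suc) G k n)

  -- In each number of variables this is `Newton-complete` for the list of variables. The integer
  -- enters through `const` so that `⟦const⟧` can evaluate it.
  newton : ∀ k → CommutativeRing._*_ ΛRing (const (KS.nat k)) (h k) ≈Λ ΛS.conv (λ i → p (suc i)) h k
  newton k n = begin
    con (KS.nat k) * poly (h k) n ≈⟨ *-cong (con-nat k) ≋-refl ⟩
    PS.nat n k * poly (h k) n     ≈⟨ PS.Newton-complete n (tabulate var) k ⟩
    PS.conv n (λ i → poly (p (suc i)) n) (λ i → poly (h i) n) k ≡⟨ poly-conv (λ i → p (suc i)) h k n ⟨
    poly (ΛS.conv (λ i → p (suc i)) h k) n ∎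
    where open SetoidReasoning (CommutativeRing.setoid (polyRing n))

-- Values of h_k, of its multiparameter version and of determinants.

module Evaluations (K : CommutativeRing c ℓ) where

  open CommutativeRing K hiding (zero)
  open OverRing K
  open PowerSeries K
  open Determinants K using (sum-cong)
  open RingProperties ring using (-‿distribˡ-*; -‿distribʳ-*; -‿+-comm; -‿involutive; -0#≈0#; -1*x≈-x)
  open NaturalSolver commutativeSemiring using (solve; _:=_; _:+_; _:*_)
  open SymmetricFunctions K
  open NewtonIdentities K using (newton)
  open SetoidReasoning setoid

  private
    module ΛR = CommutativeRing ΛRing
    module ΛS = PowerSeries ΛRing
    module ΛO = OverRing ΛRing

  -- This is ∏ (1 + y_j t) / ∏ (1 - x_i t); the sign on `y` adapts the numerator to `mul`.
  pointSeries : Point → Series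
  pointSeries (d , x , y) = div* (tabulate x) (mul* (tabulate (λ i → - y i)) one)

  sum≈powerSum : ∀ {n} (x : Fin n → Carrier) k → sum (λ i → x i ^ k) ≈ powerSum k (tabulate x)
  sum≈powerSum {zero}  x k = refl
  sum≈powerSum {suc n} x k = +-congˡ (sum≈powerSum (x ∘ Fin.suc) k)

  neg-power : ∀ y k → - ((- y) ^ suc k) ≈ (- 1#) ^ k * y ^ suc k
  neg-power y zero = trans (-‿distribˡ-* (- y) 1#) (trans (*-congʳ (-‿involutive y)) (sym (*-identityˡ _)))
  neg-power y (suc k) = begin
    - (- y * (- y) ^ suc k)                  ≈⟨ -‿distribʳ-* _ _ ⟩
    - y * - ((- y) ^ suc k)                  ≈⟨ *-cong (sym (-1*x≈-x y)) (neg-power y k) ⟩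
    - 1# * y * ((- 1#) ^ k * y ^ suc k)
      ≈⟨ solve 4 (λ m y p q → m :* y :* (p :* q) := m :* p :* (y :* q)) refl _ _ _ _ ⟩
    (- 1#) ^ suc k * y ^ suc (suc k)         ∎

  neg-powerSum : ∀ {n} (y : Fin n → Carrier) k →
    - powerSum (suc k) (tabulate (λ i → - y i)) ≈ (- 1#) ^ k * sum (λ i → y i ^ suc k)
  neg-powerSum {zero}  y k = trans -0#≈0# (sym (zeroʳ _))
  neg-powerSum {suc n} y k = begin
    - ((- y₀) ^ suc k + powerSum (suc k) (tabulate (λ i → - y (Fin.suc i))))
      ≈⟨ -‿+-comm _ _ ⟨
    - ((- y₀) ^ suc k) + - powerSum (suc k) (tabulate (λ i → - y (Fin.suc i)))
      ≈⟨ +-cong (neg-power y₀ k) (neg-powerSum (y ∘ Fin.suc) k) ⟩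
    (- 1#) ^ k * y₀ ^ suc k + (- 1#) ^ k * sum (λ i → y (Fin.suc i) ^ suc k)
      ≈⟨ distribˡ _ _ _ ⟨
    (- 1#) ^ k * sum (λ i → y i ^ suc k) ∎
    where y₀ = y Fin.zero

  module _ (pt : Point) (ev : Evaluation pt) where

    open Evaluation ev
    open RingMorphisms.IsRingHomomorphism isRingHomomorphism

    ⟦conv⟧ : ∀ Q G k → ⟦ ΛS.conv Q G k ⟧ ≈ conv (⟦_⟧ ∘ Q) (⟦_⟧ ∘ G) k
    ⟦conv⟧ Q G zero    = 0#-homo
    ⟦conv⟧ Q G (suc k) =
      trans (+-homo _ _) (+-cong (*-homo _ _) (⟦conv⟧ (Q ∘ suc) G k))

    Newton-⟦h⟧ : Newton (λ i → ⟦ p (suc i) ⟧) (λ k → ⟦ h k ⟧)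
    Newton-⟦h⟧ k = begin
      nat k * ⟦ h k ⟧                        ≈⟨ *-congʳ (⟦const⟧ (nat k)) ⟨
      ⟦ const (nat k) ⟧ * ⟦ h k ⟧            ≈⟨ *-homo _ _ ⟨
      ⟦ const (nat k) ΛR.* h k ⟧              ≈⟨ ⟦⟧-cong (newton k) ⟩
      ⟦ ΛS.conv (λ i → p (suc i)) h k ⟧      ≈⟨ ⟦conv⟧ (λ i → p (suc i)) h k ⟩
      conv (λ i → ⟦ p (suc i) ⟧) (λ k → ⟦ h k ⟧) k ∎

    Newton-pointSeries : Newton (λ i → ⟦ p (suc i) ⟧) (pointSeries pt)
    Newton-pointSeries = Newton-cong
      (λ i → trans (+-cong (sym (sum≈powerSum x (suc i)))
                           (trans (+-identityˡ _) (neg-powerSum y i)))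
                   (sym (⟦p⟧ (suc i))))
      (Newton-div* (tabulate x) (Newton-mul* (tabulate (λ i → - y i)) (Newton-one {λ _ → 0#} (λ _ → refl))))
      where
      x = proj₁ (proj₂ pt)
      y = proj₂ (proj₂ pt)

    ⟦h0⟧ : ⟦ h 0 ⟧ ≈ 1#
    ⟦h0⟧ = trans (⟦⟧-cong h0≈1) 1#-homo
      where
      h0≈1 : h 0 ≈Λ ΛR.1#
      h0≈1 n = CommutativeRing.+-identityʳ (Polynomials.polyRing K n) _

    ⟦h⟧ : (∀ k {x y} → nat (suc k) * x ≈ nat (suc k) * y → x ≈ y) → ∀ k → ⟦ h k ⟧ ≈ pointSeries pt k
    ⟦h⟧ cancel = Newton-unique cancel Newton-⟦h⟧ Newton-pointSeries
      (trans ⟦h0⟧ (sym (trans (div*-head (tabulate x) _) (mul*-head (tabulate (λ i → - y i)) one))))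
      where
      x = proj₁ (proj₂ pt)
      y = proj₂ (proj₂ pt)

    ⟦-1^⟧ : ∀ k → ⟦ (ΛR.- ΛR.1#) ΛO.^ k ⟧ ≈ (- 1#) ^ k
    ⟦-1^⟧ zero    = 1#-homo
    ⟦-1^⟧ (suc k) = trans (*-homo _ _) (*-cong (trans (-‿homo _) (-‿cong 1#-homo)) (⟦-1^⟧ k))

    ⟦sum⟧ : ∀ {n} (f : Fin n → Λ) → ⟦ ΛO.sum f ⟧ ≈ sum (⟦_⟧ ∘ f)
    ⟦sum⟧ {zero}  f = 0#-homo
    ⟦sum⟧ {suc n} f = trans (+-homo _ _) (+-congˡ (⟦sum⟧ (f ∘ Fin.suc)))

    ⟦det⟧ : ∀ {n} (M : Fin n → Fin n → Λ) (M′ : Fin n → Fin n → Carrier) →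
      (∀ r s → ⟦ M r s ⟧ ≈ M′ r s) → ⟦ ΛO.det M ⟧ ≈ det M′
    ⟦det⟧ {zero}  M M′ e = 1#-homo
    ⟦det⟧ {suc n} M M′ e = trans (⟦sum⟧ term)
      (sum-cong {f = ⟦_⟧ ∘ term} {g = λ j → (- 1#) ^ toℕ j * (M′ Fin.zero j * det (λ r s → M′ (Fin.suc r) (punchIn j s)))}
      (λ j → trans (*-homo _ _) (*-cong (⟦-1^⟧ (toℕ j))
        (trans (*-homo _ _) (*-cong (e Fin.zero j)
          (⟦det⟧ (λ r s → M (Fin.suc r) (punchIn j s)) _ (λ r s → e (Fin.suc r) (punchIn j s))))))))
      where
      term : Fin (suc n) → Λ
      term j = (ΛR.- ΛR.1#) ΛO.^ toℕ j ΛR.* (M Fin.zero j ΛR.* ΛO.det (λ r s → M (Fin.suc r) (punchIn j s)))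

    ⟦∑⟧ : ∀ n (f : ℕ → ℕ) (F : ℕ → Λ) (Q G : Series) →
      (∀ i → i < n → ⟦ F (f i) ⟧ ≈ Q i * G (n ∸ suc i)) →
      ⟦ ΛO.∑ (applyUpTo f n) F ⟧ ≈ conv Q G n
    ⟦∑⟧ zero    f F Q G e = 0#-homo
    ⟦∑⟧ (suc n) f F Q G e = trans (+-homo _ _)
      (+-cong (e 0 (s≤s z≤n)) (⟦∑⟧ n (f ∘ suc) F (Q ∘ suc) G (λ i l → e (suc i) (s≤s l))))

    open Multiparameter K using (Sequence; multiH)

    -- The signed elementary polynomials are the coefficients of ∏ (1 - a_l t), so the defining sum
    -- is a convolution of that product with the series of the h_i.
    ⟦multiH⟧ : (∀ k → ⟦ h k ⟧ ≈ pointSeries pt k) → ∀ k (α : Sequence) →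
      ⟦ multiH (+ suc k) α ⟧ ≈ mul* (map (λ i → α (+ i)) [1⋯ k ]) (pointSeries pt) (suc k)
    ⟦multiH⟧ ⟦h⟧ k α = begin
      ⟦ multiH (+ suc k) α ⟧
        ≈⟨ ⟦∑⟧ (suc k) suc _ (H ∘ suc) (mul* as one) (λ i _ → begin
          ⟦ const ((- 1#) ^ (k ∸ i) * elementary (k ∸ i) as) ΛR.* h (suc i) ⟧
            ≈⟨ *-homo _ _ ⟩
          ⟦ const ((- 1#) ^ (k ∸ i) * elementary (k ∸ i) as) ⟧ * ⟦ h (suc i) ⟧
            ≈⟨ *-cong (⟦const⟧ _) (⟦h⟧ (suc i)) ⟩
          (- 1#) ^ (k ∸ i) * elementary (k ∸ i) as * H (suc i)
            ≈⟨ *-congʳ (elementary-series as (k ∸ i)) ⟩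
          mul* as one (k ∸ i) * H (suc i)
            ≈⟨ *-comm _ _ ⟩
          H (suc i) * mul* as one (k ∸ i) ∎) ⟩
      conv (H ∘ suc) (mul* as one) (suc k)
        ≈⟨ +-identityˡ _ ⟨
      0# + conv (H ∘ suc) (mul* as one) (suc k)
        -- The defining sum starts at i = 1. The term i = 0 may be added, since e_{k+1} of k numbers
        -- is zero, and it completes the convolution.
        ≈⟨ +-congʳ (trans (*-congˡ (mul*-degree as (suc k) degree)) (zeroʳ (H 0))) ⟨
      conv H (mul* as one) (suc (suc k))
        ≈⟨ conv-mul* H as one (suc (suc k)) ⟩
      mul* as (conv H one) (suc (suc k))
        ≈⟨ mul*-shift as (suc k) ⟩
      mul* as H (suc k) ∎
      where
      as = map (λ i → α (+ i)) [1⋯ k ]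
      H  = pointSeries pt
      degree : length as < suc k
      degree = s≤s (ℕₚ.≤-reflexive (≡.trans (Listₚ.length-map _ [1⋯ k ]) (Listₚ.length-applyUpTo suc k)))
      -- `conv H one` is t H(t), which accounts for the shift of the index by one.
      mul*-shift : ∀ ys k → mul* ys (conv H one) (suc k) ≈ mul* ys H k
      mul*-shift [] k = conv-one H k
      mul*-shift (y ∷ ys) zero = trans (+-cong (mul*-shift ys zero)
        (trans (*-congˡ (mul*-head ys (conv H one))) (zeroʳ _))) (+-identityʳ _)
      mul*-shift (y ∷ ys) (suc k) = +-cong (mul*-shift ys (suc k)) (*-congˡ (mul*-shift ys k))

-- Arithmetic of integer indices.

m⊖1+n+1≡m⊖n : ∀ m n → m ⊖ suc n ℤ.+ 1ℤ ≡ m ⊖ n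
m⊖1+n+1≡m⊖n m n = ≡.trans (ℤₚ.distribˡ-⊖-+-pos 1 m (suc n))
  (≡.trans (≡.cong (_⊖ suc n) (ℕₚ.+-comm m 1)) (ℤₚ.[1+m]⊖[1+n]≡m⊖n m n))

1-[m⊖n+1]≡n⊖m : ∀ m n → 1ℤ ℤ.- (m ⊖ n ℤ.+ 1ℤ) ≡ n ⊖ m
1-[m⊖n+1]≡n⊖m m n = ≡.trans (lemma (m ⊖ n)) (≡.sym (ℤₚ.⊖-swap n m))
  where
  lemma : ∀ x → 1ℤ ℤ.- (x ℤ.+ 1ℤ) ≡ ℤ.- x
  lemma = ℤ-Solver.solve-∀

m+[1-[1+n]]≡m⊖n : ∀ m n → + m ℤ.+ (1ℤ ℤ.- + suc n) ≡ m ⊖ n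
m+[1-[1+n]]≡m⊖n m n = ≡.trans (lemma (+ m) (+ n)) (ℤₚ.m-n≡m⊖n m n)
  where
  lemma : ∀ x y → x ℤ.+ (1ℤ ℤ.- (1ℤ ℤ.+ y)) ≡ x ℤ.- y
  lemma = ℤ-Solver.solve-∀

m⊖1+i+1+j≡m+j⊖i : ∀ m i j → m ⊖ suc i ℤ.+ + suc j ≡ m ℕ.+ j ⊖ i
m⊖1+i+1+j≡m+j⊖i m i j = ≡.trans (ℤₚ.distribˡ-⊖-+-pos (suc j) m (suc i))
  (≡.trans (≡.cong (_⊖ suc i) (ℕₚ.+-suc m j)) (ℤₚ.[1+m]⊖[1+n]≡m⊖n (m ℕ.+ j) i))

-- With `m` the length of row i + 1, the `k` factors belonging to the entry in column j + 1 end at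
-- the index k - j; by this equation that end depends on the row alone.
m+j⊖i≡1+k⇒m⊖1+i≡k⊖j : ∀ m i j k → m ℕ.+ j ⊖ i ≡ + suc k → m ⊖ suc i ≡ k ⊖ j
m+j⊖i≡1+k⇒m⊖1+i≡k⊖j m i j k e = begin
  m ⊖ suc i                      ≡⟨ lemma (m ⊖ suc i) (+ suc j) ⟩
  (m ⊖ suc i ℤ.+ + suc j) ℤ.- + suc j ≡⟨ ≡.cong (ℤ._- + suc j) (≡.trans (m⊖1+i+1+j≡m+j⊖i m i j) e) ⟩
  + suc k ℤ.- + suc j            ≡⟨ ℤₚ.m-n≡m⊖n (suc k) (suc j) ⟩
  suc k ⊖ suc j                  ≡⟨ ℤₚ.[1+m]⊖[1+n]≡m⊖n k j ⟩
  k ⊖ j                          ∎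
  where
  open ≡.≡-Reasoning
  lemma : ∀ x y → x ≡ (x ℤ.+ y) ℤ.- y
  lemma = ℤ-Solver.solve-∀

-- Row lengths, column lengths and the boundary of a Young diagram.

part-suc-≤ : ∀ {rs} → Linked _≥_ rs → ∀ i → part rs (suc (suc i)) ≤ part rs (suc i)
part-suc-≤ []      i       = z≤n
part-suc-≤ [-]     i       = z≤n
part-suc-≤ (p ∷ l) zero    = p
part-suc-≤ (p ∷ l) (suc i) = part-suc-≤ l i

part-antitone : ∀ {rs} → Linked _≥_ rs → ∀ {i j} → i ≤ j → part rs (suc j) ≤ part rs (suc i)
part-antitone {rs} l {i} {j} i≤j = go (ℕₚ.≤⇒≤′ i≤j)
  where
  go : ∀ {j} → i ℕ.≤′ j → part rs (suc j) ≤ part rs (suc i)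
  go (ℕ.≤′-reflexive ≡.refl) = ℕₚ.≤-refl
  go (ℕ.≤′-step q)           = ℕₚ.≤-trans (part-suc-≤ l _) (go q)

part-end : ∀ rs {i} → length rs ≤ i → part rs (suc i) ≡ 0
part-end []       _       = ≡.refl
part-end (r ∷ rs) (s≤s l) = part-end rs l

-- In a decreasing list the entries exceeding `c` form a prefix, and the two hypotheses locate its
-- end.
count-≡ : ∀ {rs} → Linked _≥_ rs → ∀ i c → part rs (suc i) ≤ c → (∀ k → k < i → c < part rs (suc k)) →
          length (filter (suc c ℕₚ.≤?_) rs) ≡ i
count-≡ {[]}     l zero    c p q = ≡.refl
count-≡ {[]}     l (suc i) c p q = contradiction (q 0 (s≤s z≤n)) λ ()
count-≡ {r ∷ rs} l zero    c p q = ≡.trans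
  (≡.cong length (Listₚ.filter-reject (suc c ℕₚ.≤?_) (ℕₚ.≤⇒≯ p)))
  (count-≡ (Linked.tail l) zero c (ℕₚ.≤-trans (part-suc-≤ l 0) p) (λ _ ()))
count-≡ {r ∷ rs} l (suc i) c p q = ≡.trans
  (≡.cong length (Listₚ.filter-accept (suc c ℕₚ.≤?_) (q 0 (s≤s z≤n))))
  (≡.cong suc (count-≡ (Linked.tail l) i c p (λ k k<i → q (suc k) (s≤s k<i))))

count-> : ∀ {rs} → Linked _≥_ rs → ∀ i c → c < part rs (suc i) → i < length (filter (suc c ℕₚ.≤?_) rs)
count-> {r ∷ rs} l zero    c p
  rewrite Listₚ.filter-accept (suc c ℕₚ.≤?_) {xs = rs} p = s≤s z≤n
count-> {r ∷ rs} l (suc i) c p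
  rewrite Listₚ.filter-accept (suc c ℕₚ.≤?_) {xs = rs}
            (ℕₚ.≤-trans p (part-antitone l {0} {suc i} z≤n)) = s≤s (count-> (Linked.tail l) i c p)

module _ {p} {P : Pred ℕ p} (P? : Decidable P) where

  -- A condition inherited by preceding indices selects an initial segment, so a count such as
  -- `diagonalLength` also tells where the segment ends.
  filter-prefix : ∀ n (g : ℕ → ℕ) → (∀ i → P (g (suc i)) → P (g i)) →
    let d = length (filter P? (applyUpTo g n)) in
    (∀ i → i < d → P (g i)) × (d < n → ¬ P (g d)) × d ≤ n
  filter-prefix zero    g down = (λ _ ()) , (λ ()) , z≤n
  filter-prefix (suc n) g down with P? (g 0) | filter-prefix n (g ∘ suc) (down ∘ suc)
  ... | yes p | below , at , d≤n =
    (λ { zero _ → p ; (suc i) (s≤s l) → below i l }) , (λ { (s≤s l) → at l }) , s≤s d≤n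
  ... | no ¬p | below , at , d≤n with length (filter P? (applyUpTo (g ∘ suc) n))
  ...   | zero  = (λ _ ()) , (λ _ → ¬p) , z≤n
  ...   | suc d = contradiction (down 0 (below 0 (s≤s z≤n))) ¬p

-- A boundary point (i , c) of μ separates the rows 1, …, i, which reach column c, from the others, which do not pass it.
module Boundary (μ : YoungDiagram) where

  open YoungDiagram μ

  ρ : ℕ → ℕ
  ρ i = row μ (suc i)

  ρ-antitone : ∀ {i j} → i ≤ j → ρ j ≤ ρ i
  ρ-antitone = part-antitone decreasing

  OnBoundary : ℕ → ℕ → Set
  OnBoundary i c = ρ i ≤ c × (∀ k → k < i → c ≤ ρ k)

  col-boundary : ∀ {i c} → OnBoundary i c → OnBoundary i (suc c) → col μ (suc c) ≡ i
  col-boundary (p , _) (_ , q) = count-≡ decreasing _ _ p q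

  row-boundary : ∀ i → OnBoundary (suc i) (ρ i)
  row-boundary i = ρ-antitone (ℕₚ.n≤1+n i) , λ { k (s≤s k≤i) → ρ-antitone k≤i }

  i<col : ∀ i l → l < ρ i → i < col μ (suc l)
  i<col = count-> decreasing

  private
    d : ℕ
    d = diagonalLength μ
    prefix = filter-prefix (λ i → i ℕₚ.≤? row μ i) (len μ) suc
      (λ i p → ℕₚ.≤-trans (ℕₚ.n≤1+n (suc i)) (ℕₚ.≤-trans p (ρ-antitone (ℕₚ.n≤1+n i))))

  diagonalLength≤len : d ≤ len μ
  diagonalLength≤len = proj₂ (proj₂ prefix)

  diagonal-boundary : OnBoundary d d
  diagonal-boundary = ρd≤d , d≤ρ
    where
    ρd≤d : ρ d ≤ d
    ρd≤d with ℕₚ.m≤n⇒m<n∨m≡n diagonalLength≤len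
    ... | inj₁ d<len = ℕₚ.≮⇒≥ (proj₁ (proj₂ prefix) d<len)
    -- Here every nonempty row reaches the diagonal, and the next row is empty.
    ... | inj₂ d≡len = ℕₚ.≤-trans (ℕₚ.≤-reflexive (part-end rows (ℕₚ.≤-reflexive (≡.sym d≡len)))) z≤n
    d≤ρ : ∀ k → k < d → d ≤ ρ k
    d≤ρ k k<d with d in eq
    d≤ρ k (s≤s k≤d′) | suc d′ = ℕₚ.≤-trans
      (proj₁ prefix d′ (ℕₚ.≤-reflexive (≡.sym eq))) (ρ-antitone k≤d′)

  module _ {p} (P : ℕ → ℕ → Set p)
    (right : ∀ i c → col μ (suc c) ≡ i → P i c → P i (suc c))
    (up    : ∀ i → P (suc i) (ρ i) → P i (ρ i))
    (N : ℕ) (len≤N : len μ ≤ N) (start : P N 0)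
    where

    -- The point (i , c) is reached from (i + 1 , ρ i) by one step up and then steps to the right.
    -- The premise `up` is confined to column `ρ i` because the boundary passes from i + 1 to i only
    -- there.
    boundary-path : ∀ {i c} → i ≤ N → OnBoundary i c → P i c
    boundary-path {i} i≤N = walk (N ∸ i) i (ℕₚ.m∸n+n≡m i≤N)
      where
      climb : ∀ i → P i (ρ i) → ∀ {c} → ρ i ℕ.≤′ c → OnBoundary i c → P i c
      climb i s (ℕ.≤′-reflexive ≡.refl) _ = s
      climb i s (ℕ.≤′-step {c} l) (p , q) = right i c (col-boundary here (p , q)) (climb i s l here)
        where
        here : OnBoundary i c
        here = ℕₚ.≤′⇒≤ l , λ k k<i → ℕₚ.≤-trans (ℕₚ.n≤1+n c) (q k k<i)
      walk : ∀ k i → k ℕ.+ i ≡ N → ∀ {c} → OnBoundary i c → P i c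
      -- Row N + 1 is empty as len μ ≤ N, so (N , 0) is the point (N , ρ N).
      walk zero    i ≡.refl b@(p , _) = climb i (≡.subst (P i) (≡.sym (part-end rows len≤N)) start) (ℕₚ.≤⇒≤′ p) b
      walk (suc k) i e      b@(p , _) =
        climb i (up i (walk k (suc i) (≡.trans (ℕₚ.+-suc k i) e) (row-boundary i))) (ℕₚ.≤⇒≤′ p) b

-- The series at (x(μ);y(μ)) and the value of the determinant.

module SpecialPoint (K : CommutativeRing c ℓ) (a : ℤ → CommutativeRing.Carrier K) where

  open CommutativeRing K hiding (zero)
  open OverRing K
  open PowerSeries K
  open Determinants K
  open CoefficientMatrix K
  open Evaluations K
  open Multiparameter K
  open RingProperties ring using (-‿involutive; -0#≈0#)
  open SetoidReasoning setoid

  private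
    s : ℕ → Carrier
    s j = a (0 ⊖ j)

  -- ∏_{l = 1}^n (1 - a_l t), which for n < 0 is ∏_{l = n+1}^0 (1 - a_l t)⁻¹
  shifted : ℤ → Series → Series
  shifted (+ n)    = mul* (applyUpTo (λ l → a (+ suc l)) n)
  shifted -[1+ n ] = div* (applyUpTo s (suc n))

  -- The new factor lengthens the product when the index is nonnegative and cancels the last
  -- denominator when it is negative, so one recursion serves all integers.
  shifted-suc : ∀ m i F → shifted (suc m ⊖ i) F ≗ mul (a (suc m ⊖ i)) (shifted (m ⊖ i) F)
  shifted-suc m zero F k = trans
    (reflexive (≡.cong (λ as → mul* as F k) (≡.sym (Listₚ.applyUpTo-∷ʳ (λ l → a (+ suc l)) m))))
    (mul*-∷ʳ (applyUpTo (λ l → a (+ suc l)) m) (a (+ suc m)) F k)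
  shifted-suc zero (suc zero) F k = sym (mul-div (a (+ 0)) F k)
  shifted-suc zero (suc (suc i)) F k = sym (begin
    mul x (div* (applyUpTo s (suc (suc i))) F) k
      ≈⟨ mul-cong refl (λ k → reflexive (≡.cong (λ as → div* as F k) (≡.sym (Listₚ.applyUpTo-∷ʳ s (suc i))))) k ⟩
    mul x (div* (applyUpTo s (suc i) ∷ʳ x) F) k
      ≈⟨ mul-cong refl (λ k → reflexive (≡.cong (_$ k) (Listₚ.foldr-∷ʳ div F x (applyUpTo s (suc i))))) k ⟩
    mul x (div* (applyUpTo s (suc i)) (div x F)) k
      ≈⟨ div*-mul (applyUpTo s (suc i)) x (div x F) k ⟨
    div* (applyUpTo s (suc i)) (mul x (div x F)) k
      ≈⟨ div*-cong (applyUpTo s (suc i)) (mul-div x F) k ⟩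
    div* (applyUpTo s (suc i)) F k ∎)
    where x = s (suc i)
  shifted-suc (suc m) (suc i) F k
    rewrite ℤₚ.[1+m]⊖[1+n]≡m⊖n (suc m) i | ℤₚ.[1+m]⊖[1+n]≡m⊖n m i = shifted-suc m i F k

  shifted-cancel : ∀ j F → mul* (applyUpTo s j) (shifted (0 ⊖ j) F) ≗ F
  shifted-cancel zero    F k = refl
  shifted-cancel (suc j) F k = mul*-div* (applyUpTo s (suc j)) F k

  shifted-cancel′ : ∀ j F → shifted (0 ⊖ j) (mul* (applyUpTo s j) F) ≗ F
  shifted-cancel′ zero    F k = refl
  shifted-cancel′ (suc j) F k = div*-mul* (applyUpTo s (suc j)) F k

  -- Starting from - j, the factors with indices 1 - j, ..., n - j are appended one at a time,
  -- whatever the sign of n - j.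
  shifted-⊖ : ∀ n j F → shifted (n ⊖ j) F ≗ mul* (applyUpTo (λ l → a (suc l ⊖ j)) n) (shifted (0 ⊖ j) F)
  shifted-⊖ zero    j F k = refl
  shifted-⊖ (suc n) j F k = begin
    shifted (suc n ⊖ j) F k
      ≈⟨ shifted-suc n j F k ⟩
    mul (f n) (shifted (n ⊖ j) F) k
      ≈⟨ mul-cong refl (shifted-⊖ n j F) k ⟩
    mul (f n) (mul* (applyUpTo f n) (shifted (0 ⊖ j) F)) k
      ≈⟨ mul*-∷ʳ (applyUpTo f n) (f n) _ k ⟨
    mul* (applyUpTo f n ∷ʳ f n) (shifted (0 ⊖ j) F) k
      ≡⟨ ≡.cong (λ as → mul* as (shifted (0 ⊖ j) F) k) (Listₚ.applyUpTo-∷ʳ f n) ⟩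
    mul* (applyUpTo f (suc n)) (shifted (0 ⊖ j) F) k ∎
    where
    f : ℕ → Carrier
    f l = a (suc l ⊖ j)

  mul*-congˡ : ∀ {xs ys} F → Pointwise _≈_ xs ys → mul* xs F ≗ mul* ys F
  mul*-congˡ F []       k = refl
  mul*-congˡ F (p ∷ ps)   = mul-cong p (mul*-congˡ F ps)

  div*-congˡ : ∀ {xs ys} F → Pointwise _≈_ xs ys → div* xs F ≗ div* ys F
  div*-congˡ F []       k = refl
  div*-congˡ F (p ∷ ps)   = div-cong p (div*-congˡ F ps)

  tabulate≈applyUpTo : ∀ {n} {x : Fin n → Carrier} {f : ℕ → Carrier} →
    (∀ i → x i ≈ f (toℕ i)) → Pointwise _≈_ (tabulate x) (applyUpTo f n)
  tabulate≈applyUpTo {zero}  p = []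
  tabulate≈applyUpTo {suc n} p = p Fin.zero ∷ tabulate≈applyUpTo (p ∘ Fin.suc)

  applyUpTo-cong : ∀ {f g : ℕ → Carrier} → (∀ i → f i ≈ g i) → ∀ n → Pointwise _≈_ (applyUpTo f n) (applyUpTo g n)
  applyUpTo-cong p zero    = []
  applyUpTo-cong p (suc n) = p 0 ∷ applyUpTo-cong (p ∘ suc) n

  rowValue colValue : YoungDiagram → ℕ → Carrier
  rowValue μ i = a (row μ (suc i) ⊖ i)
  colValue μ l = a (suc l ⊖ col μ (suc l))

  -- Chosen so that the product formula below holds at the boundary point (N , 0).
  H : YoungDiagram → ℕ → Series
  H μ N = mul* (applyUpTo s N) (div* (applyUpTo (rowValue μ) N) one)

  module _ (μ : YoungDiagram) (N : ℕ) (len≤N : len μ ≤ N) where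

    open Boundary μ

    private
      b γ : ℕ → Carrier
      b = rowValue μ
      γ = colValue μ

    Splits : ℕ → ℕ → Set ℓ
    Splits i c = mul* (applyUpTo γ c) one ≗ mul* (applyUpTo b i) (shifted (c ⊖ i) (H μ N))

    -- Each boundary edge corresponds to one factor 1 - a_z t. A step to the right introduces it on
    -- both sides, as a new γ on the left and in `shifted` on the right; a step up moves it from the
    -- product over `b` into `shifted`.
    splits : ∀ {i c} → i ≤ N → OnBoundary i c → Splits i c
    splits = boundary-path Splits right up N len≤N corner
      where
      right : ∀ i c → col μ (suc c) ≡ i → Splits i c → Splits i (suc c)
      right i c e p k = begin
        mul* (applyUpTo γ (suc c)) one k
          ≡⟨ ≡.cong (λ as → mul* as one k) (Listₚ.applyUpTo-∷ʳ γ c) ⟨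
        mul* (applyUpTo γ c ∷ʳ γ c) one k
          ≈⟨ mul*-∷ʳ (applyUpTo γ c) (γ c) one k ⟩
        mul (γ c) (mul* (applyUpTo γ c) one) k
          ≈⟨ mul-cong (reflexive (≡.cong (λ z → a (suc c ⊖ z)) e)) p k ⟩
        mul (a (suc c ⊖ i)) (mul* (applyUpTo b i) (shifted (c ⊖ i) (H μ N))) k
          ≈⟨ mul*-mul (applyUpTo b i) _ _ k ⟨
        mul* (applyUpTo b i) (mul (a (suc c ⊖ i)) (shifted (c ⊖ i) (H μ N))) k
          ≈⟨ mul*-cong (applyUpTo b i) (shifted-suc c i (H μ N)) k ⟨
        mul* (applyUpTo b i) (shifted (suc c ⊖ i) (H μ N)) k ∎
      up : ∀ i → Splits (suc i) (ρ i) → Splits i (ρ i)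
      up i p k = begin
        mul* (applyUpTo γ (ρ i)) one k
          ≈⟨ p k ⟩
        mul* (applyUpTo b (suc i)) (shifted (ρ i ⊖ suc i) (H μ N)) k
          ≡⟨ ≡.cong (λ as → mul* as (shifted (ρ i ⊖ suc i) (H μ N)) k) (Listₚ.applyUpTo-∷ʳ b i) ⟨
        mul* (applyUpTo b i ∷ʳ b i) (shifted (ρ i ⊖ suc i) (H μ N)) k
          ≡⟨ ≡.cong (_$ k) (Listₚ.foldr-∷ʳ mul _ (b i) (applyUpTo b i)) ⟩
        mul* (applyUpTo b i) (mul (b i) (shifted (ρ i ⊖ suc i) (H μ N))) k
          ≈⟨ mul*-cong (applyUpTo b i) step k ⟩
        mul* (applyUpTo b i) (shifted (ρ i ⊖ i) (H μ N)) k ∎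
        where
        step : mul (b i) (shifted (ρ i ⊖ suc i) (H μ N)) ≗ shifted (ρ i ⊖ i) (H μ N)
        step = ≡.subst (λ z → mul (a z) (shifted (ρ i ⊖ suc i) (H μ N)) ≗ shifted z (H μ N))
          (ℤₚ.[1+m]⊖[1+n]≡m⊖n (ρ i) i) (λ k → sym (shifted-suc (ρ i) (suc i) (H μ N) k))
      corner : Splits N 0
      corner k = begin
        one k
          ≈⟨ mul*-div* (applyUpTo b N) one k ⟨
        mul* (applyUpTo b N) (div* (applyUpTo b N) one) k
          ≈⟨ mul*-cong (applyUpTo b N) (shifted-cancel′ N _) k ⟨
        mul* (applyUpTo b N) (shifted (0 ⊖ N) (H μ N)) k ∎

    -- At (d , d) the difference c - i is 0, so `shifted` is the identity and the product formula
    -- can be solved for `H μ N`.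
    H-diagonal : H μ N ≗ div* (applyUpTo b (diagonalLength μ)) (mul* (applyUpTo γ (diagonalLength μ)) one)
    H-diagonal k = begin
      H μ N k                              ≈⟨ div*-mul* bs (H μ N) k ⟨
      div* bs (mul* bs (H μ N)) k            ≡⟨ ≡.cong (λ z → div* bs (mul* bs (shifted z (H μ N))) k) (ℤₚ.n⊖n≡0 d) ⟨
      div* bs (mul* bs (shifted (d ⊖ d) (H μ N))) k
        ≈⟨ div*-cong bs (splits (ℕₚ.≤-trans diagonalLength≤len len≤N) diagonal-boundary) k ⟨
      div* bs (mul* (applyUpTo γ d) one) k ∎
      where
      d = diagonalLength μ
      bs = applyUpTo b d

    frobeniusX : ∀ i → a (frobeniusP μ (suc i) ℤ.+ 1ℤ) ≈ b i
    frobeniusX i = reflexive (≡.cong a (m⊖1+n+1≡m⊖n (ρ i) i))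

    frobeniusY : ∀ i → - dual a (frobeniusQ μ (suc i) ℤ.+ 1ℤ) ≈ γ i
    frobeniusY i = trans (-‿involutive _)
      (reflexive (≡.cong a (1-[m⊖n+1]≡n⊖m (col μ (suc i)) (suc i))))

    private
      d : ℕ
      d = diagonalLength μ
      xs ys : List Carrier
      xs = tabulate {n = d} (λ i → a (frobeniusP μ (suc (toℕ i)) ℤ.+ 1ℤ))
      ys = tabulate {n = d} (λ i → - dual a (frobeniusQ μ (suc (toℕ i)) ℤ.+ 1ℤ))

    frobeniusSeries : div* xs (mul* ys one) ≗ H μ N
    frobeniusSeries k = begin
      div* xs (mul* ys one) k
        ≈⟨ div*-congˡ (mul* ys one) (tabulate≈applyUpTo {d} {f = b} (λ i → frobeniusX (toℕ i))) k ⟩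
      div* (applyUpTo b d) (mul* ys one) k
        ≈⟨ div*-cong (applyUpTo b d) (mul*-congˡ one (tabulate≈applyUpTo {d} {f = γ} (λ i → frobeniusY (toℕ i)))) k ⟩
      div* (applyUpTo b d) (mul* (applyUpTo γ d) one) k
        ≈⟨ H-diagonal k ⟨
      H μ N k ∎

  -- The empty diagram is separate: its point consists of one pair (0 ; 0) although its diagonal
  -- length is 0. The pair contributes (1 + 0 t) / (1 - 0 t) = 1.
  pointSeries-point : ∀ μ N → len μ ≤ N → pointSeries (point a μ) ≗ H μ N
  pointSeries-point μ@record { rows = [] } N l k = trans (trivial k) (sym (H-diagonal μ N l k))
    where
    trivial : ∀ k → div 0# (mul (- 0#) one) k ≈ one k
    trivial k = trans (div-cong (sym -0#≈0#) (λ _ → refl) k) (div-mul (- 0#) one k)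
  pointSeries-point μ@record { rows = _ ∷ _ } N l = frobeniusSeries μ N l

  module _ (cancel : ∀ k {x y} → nat (suc k) * x ≈ nat (suc k) * y → x ≈ y)
    (μ : YoungDiagram) (N : ℕ) (len≤N : len μ ≤ N) (ev : Evaluation (point a μ)) where

    open Boundary μ
    open Evaluation ev

    private
      b γ : ℕ → Carrier
      b = rowValue μ
      γ = colValue μ
      H₀ : Series
      H₀ = H μ N

    -- The factors on the left have indices 1 - j, ..., n - j, so they amount to the factors of `s`
    -- times `shifted` at n - j. The hypothesis identifies that index with the one at the boundary
    -- point (i + 1 , ρ i), where `splits` trades `shifted` for γ and `b`.
    entrySeries-H : ∀ i j n → i < N → ρ i ⊖ suc i ≡ n ⊖ j →
      mul* (map (λ l → τ (1ℤ ℤ.- + suc j) a (+ l)) [1⋯ n ]) (pointSeries (point a μ)) ≗ entrySeries s γ ρ b i j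
    entrySeries-H i j n i<N e k = begin
      mul* (map (λ l → τ (1ℤ ℤ.- + suc j) a (+ l)) [1⋯ n ]) (pointSeries (point a μ)) k
        ≈⟨ mul*-cong (map (λ l → τ (1ℤ ℤ.- + suc j) a (+ l)) [1⋯ n ]) (pointSeries-point μ N len≤N) k ⟩
      mul* (map (λ l → τ (1ℤ ℤ.- + suc j) a (+ l)) [1⋯ n ]) H₀ k
        ≡⟨ ≡.cong (λ as → mul* as H₀ k) (Listₚ.map-applyUpTo suc _ n) ⟩
      mul* (applyUpTo (λ l → τ (1ℤ ℤ.- + suc j) a (+ suc l)) n) H₀ k
        ≈⟨ mul*-congˡ H₀ (applyUpTo-cong (λ l → reflexive (≡.cong a (m+[1-[1+n]]≡m⊖n (suc l) j))) n) k ⟩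
      mul* as H₀ k
        ≈⟨ mul*-cong as (shifted-cancel j H₀) k ⟨
      mul* as (mul* ss (shifted (0 ⊖ j) H₀)) k
        ≈⟨ mul*-mul* as ss (shifted (0 ⊖ j) H₀) k ⟩
      mul* ss (mul* as (shifted (0 ⊖ j) H₀)) k
        ≈⟨ mul*-cong ss (shifted-⊖ n j H₀) k ⟨
      mul* ss (shifted (n ⊖ j) H₀) k
        ≡⟨ ≡.cong (λ z → mul* ss (shifted z H₀) k) e ⟨
      mul* ss F k
        ≈⟨ div*-mul* bs (mul* ss F) k ⟨
      div* bs (mul* bs (mul* ss F)) k
        ≈⟨ div*-cong bs (mul*-mul* bs ss F) k ⟩
      div* bs (mul* ss (mul* bs F)) k
        ≈⟨ div*-cong bs (mul*-cong ss (splits μ N len≤N i<N (row-boundary i))) k ⟨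
      entrySeries s γ ρ b i j k ∎
      where
      as = applyUpTo (λ l → a (suc l ⊖ j)) n
      ss = applyUpTo s j
      bs = applyUpTo b (suc i)
      F  = shifted (ρ i ⊖ suc i) H₀

    -- The clauses of `multiH` for indices at most 0 agree with the coefficients too: `entrySeries`
    -- has constant term 1#, and `coefficient` is 0# at negative indices.
    ⟦multiH⟧-entry : ∀ i j → i < N →
      ⟦ multiH (ρ i ⊖ suc i ℤ.+ + suc j) (τ (1ℤ ℤ.- + suc j) a) ⟧ ≈ entry s γ ρ b j i
    ⟦multiH⟧-entry i j i<N rewrite m⊖1+i+1+j≡m+j⊖i (ρ i) i j with ρ i ℕ.+ j ⊖ i in e
    ... | + zero     = trans (⟦const⟧ 1#) (sym (trans (div*-head (applyUpTo b (suc i)) _)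
                         (trans (mul*-head (applyUpTo s j) _) (mul*-head (applyUpTo γ (ρ i)) one))))
    ... | + suc n    = trans (⟦multiH⟧ (point a μ) ev (⟦h⟧ (point a μ) ev cancel) n (τ (1ℤ ℤ.- + suc j) a))
                         (entrySeries-H i j n i<N (m+j⊖i≡1+k⇒m⊖1+i≡k⊖j (ρ i) i j n e) (suc n))
    ... | -[1+ n ]   = ⟦const⟧ 0#

    ⟦multiSchur⟧ : ⟦ multiSchur N μ a ⟧ ≈ ∏< (λ i → ∏< (λ l → b i + - γ l) (ρ i)) N
    ⟦multiSchur⟧ = begin
      ⟦ multiSchur N μ a ⟧
        ≈⟨ ⟦det⟧ (point a μ) ev {N} _ (λ r s′ → entry s γ ρ b (toℕ s′) (toℕ r)) (λ r s′ → ⟦multiH⟧-entry (toℕ r) (toℕ s′) (Finₚ.toℕ<n r)) ⟩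
      det {n = N} (λ r s′ → entry s γ ρ b (toℕ s′) (toℕ r))
        ≈⟨ det≈detᶜ {N} (λ j → entry s γ ρ b (toℕ j)) ⟩
      detᶜ N (tabulate {n = N} (λ j → entry s γ ρ b (toℕ j)))
        ≡⟨ ≡.cong (detᶜ N) (tabulate≡applyUpTo N (entry s γ ρ b)) ⟩
      detᶜ N (applyUpTo (entry s γ ρ b) N)
        ≈⟨ detᶜ-entry s γ N ρ b ⟩
      ∏< (λ i → ∏< (λ l → b i + - γ l) (ρ i)) N ∎
      where
      tabulate≡applyUpTo : ∀ n (f : ℕ → Column) → tabulate {n = n} (λ j → f (toℕ j)) ≡ applyUpTo f n
      tabulate≡applyUpTo zero    f = ≡.refl
      tabulate≡applyUpTo (suc n) f = ≡.cong (f 0 ∷_) (tabulate≡applyUpTo n (f ∘ suc))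

-- Products over the boxes of a diagram.

module Products (K : CommutativeRing c ℓ) where

  open CommutativeRing K hiding (zero)
  open OverRing K
  open Determinants K using (∏<; ∏<-cong)
  open SetoidReasoning setoid

  ∏-cong : ∀ {A : Set} {F G : A → Carrier} → (∀ x → F x ≈ G x) → ∀ xs → ∏ xs F ≈ ∏ xs G
  ∏-cong p []       = refl
  ∏-cong p (x ∷ xs) = *-cong (p x) (∏-cong p xs)

  ∏-++ : ∀ {A : Set} (F : A → Carrier) xs ys → ∏ (xs ++ ys) F ≈ ∏ xs F * ∏ ys F
  ∏-++ F []       ys = sym (*-identityˡ _)
  ∏-++ F (x ∷ xs) ys = trans (*-congˡ (∏-++ F xs ys)) (sym (*-assoc _ _ _))

  ∏-concatMap : ∀ {A B : Set} (F : B → Carrier) (g : A → List B) xs →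
    ∏ (concatMap g xs) F ≈ ∏ xs (λ x → ∏ (g x) F)
  ∏-concatMap F g []       = refl
  ∏-concatMap F g (x ∷ xs) = trans (∏-++ F (g x) (concatMap g xs)) (*-congˡ (∏-concatMap F g xs))

  ∏-applyUpTo : ∀ {A : Set} (F : A → Carrier) g n → ∏ (applyUpTo g n) F ≈ ∏< (F ∘ g) n
  ∏-applyUpTo F g n = reflexive (≡.cong (foldr _*_ 1#) (Listₚ.map-applyUpTo g F n))

  ∏<-extend : ∀ {m n} → m ≤ n → ∀ f → (∀ i → m ≤ i → f i ≈ 1#) → ∏< f m ≈ ∏< f n
  ∏<-extend {n = zero}  z≤n     f p = refl
  ∏<-extend {n = suc n} z≤n     f p =
    sym (trans (*-cong (p 0 z≤n) (sym (∏<-extend {n = n} z≤n (f ∘ suc) (λ i _ → p (suc i) z≤n)))) (*-identityˡ _))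
  ∏<-extend             (s≤s l) f p = *-congˡ (∏<-extend l (f ∘ suc) (λ i q → p (suc i) (s≤s q)))

  ∏-boxes : ∀ μ N → len μ ≤ N → (F : ℕ × ℕ → Carrier) →
    ∏ (boxes μ) F ≈ ∏< (λ i → ∏< (λ l → F (suc i , suc l)) (row μ (suc i))) N
  ∏-boxes μ N len≤N F = begin
    ∏ (boxes μ) F
      ≈⟨ ∏-concatMap F (λ i → map (i ,_) [1⋯ row μ i ]) [1⋯ len μ ] ⟩
    ∏ [1⋯ len μ ] (λ i → ∏ (map (i ,_) [1⋯ row μ i ]) F)
      ≈⟨ ∏-applyUpTo _ suc (len μ) ⟩
    ∏< (λ i → ∏ (map (suc i ,_) [1⋯ row μ (suc i) ]) F) (len μ)
      ≈⟨ ∏<-cong (len μ) (λ i _ → trans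
           (reflexive (≡.cong (λ xs → ∏ xs F) (Listₚ.map-applyUpTo suc (suc i ,_) (row μ (suc i)))))
           (∏-applyUpTo F (λ l → suc i , suc l) (row μ (suc i)))) ⟩
    ∏< (λ i → ∏< (λ l → F (suc i , suc l)) (row μ (suc i))) (len μ)
      -- The rows beyond len μ are empty and contribute empty products.
      ≈⟨ ∏<-extend len≤N _ (λ i p → reflexive
           (≡.cong (∏< (λ l → F (suc i , suc l))) (part-end (YoungDiagram.rows μ) p))) ⟩
    ∏< (λ i → ∏< (λ l → F (suc i , suc l)) (row μ (suc i))) N ∎

-- Cancellation and nonvanishing in a Heyting field.

module FieldProperties (K : HeytingField c ℓ₁ ℓ₂) where

  open HeytingField K using (tight; #⇒invertible)
  open CommutativeRing (fieldRing K) hiding (zero)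
  open RingProperties ring using (-0#≈0#; -‿distribʳ-*)
  open Determinants (fieldRing K) using (∏<)
  open SetoidReasoning setoid

  -- The hypothesis on `x` is a mere negation and yields no inverse of `x`. By tightness it suffices
  -- to refute that `y` is apart from 0#, and in that case `y` is the one that can be inverted.
  x*y≈0⇒y≈0 : ∀ {x y} → x * y ≈ 0# → ¬ x ≈ 0# → y ≈ 0#
  x*y≈0⇒y≈0 {x} {y} xy≈0 x≉0 = proj₁ (tight y 0#) λ y#0 →
    let (w , w*[y-0]≈1 , _) = #⇒invertible y#0 in
    x≉0 (begin
      x                  ≈⟨ *-identityʳ x ⟨
      x * 1#             ≈⟨ *-congˡ w*[y-0]≈1 ⟨
      x * (w * (y - 0#)) ≈⟨ *-congˡ (*-congˡ (trans (+-congˡ -0#≈0#) (+-identityʳ y))) ⟩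
      x * (w * y)        ≈⟨ *-congˡ (*-comm w y) ⟩
      x * (y * w)        ≈⟨ *-assoc x y w ⟨
      x * y * w          ≈⟨ *-congʳ xy≈0 ⟩
      0# * w             ≈⟨ zeroˡ w ⟩
      0#                 ∎)

  *-cancelˡ : ∀ {k x y} → ¬ k ≈ 0# → k * x ≈ k * y → x ≈ y
  *-cancelˡ {k} {x} {y} k≉0 e = GroupProperties.x∙y⁻¹≈ε⇒x≈y +-group x y (x*y≈0⇒y≈0 (begin
    k * (x - y)       ≈⟨ distribˡ k x (- y) ⟩
    k * x + k * - y   ≈⟨ +-congˡ (-‿distribʳ-* k y) ⟨
    k * x - k * y     ≈⟨ GroupProperties.x≈y⇒x∙y⁻¹≈ε +-group e ⟩
    0#                ∎) k≉0)

  ∏<-nonzero : ¬ 1# ≈ 0# → ∀ n f → (∀ i → i < n → ¬ f i ≈ 0#) → ¬ ∏< f n ≈ 0#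
  ∏<-nonzero 1≉0 zero    f p = 1≉0
  ∏<-nonzero 1≉0 (suc n) f p e =
    ∏<-nonzero 1≉0 n (f ∘ suc) (λ i l → p (suc i) (s≤s l)) (x*y≈0⇒y≈0 e (p 0 (s≤s z≤n)))

theorem11 : ∀ {c ℓ₁ ℓ₂ : Level} (K : HeytingField c ℓ₁ ℓ₂) → CharacteristicZero (fieldRing K) →
    let open OverField K in
    (a : ℤ → Carrier) →
    ((μ : YoungDiagram) (N : ℕ) → len μ ≤ N → (ev : Evaluation (point a μ)) →
    (⟦ ev ⟧ (multiSchur N μ a)
    ≈ ∏ (boxes μ) λ (i , j) → a (row μ i ⊖ i ℤ.+ 1ℤ) - a (j ⊖ col μ j))
    × (∏ (boxes μ) (λ (i , j) → a (row μ i ⊖ i ℤ.+ 1ℤ) - a (j ⊖ col μ j))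
    ≈ ∏ (boxes μ) λ (i , j) → a (row μ i ⊖ i ℤ.+ 1ℤ) + dual a (col μ j ⊖ j ℤ.+ 1ℤ)))
    × ((∀ i j → i ≢ j → ¬ (a i ≈ a j)) →
    (μ : YoungDiagram) (N : ℕ) → len μ ≤ N → (ev : Evaluation (point a μ)) →
    ¬ (⟦ ev ⟧ (multiSchur N μ a) ≈ 0#))
theorem11 K char0 a =
    (λ μ N len≤N ev →
        trans (schur μ N len≤N ev) (sym (trans (∏-boxes μ N len≤N _)
          (∏<-cong N (λ i _ → ∏<-cong (row μ (suc i)) (λ l _ →
            +-congʳ (reflexive (≡.cong a (m⊖1+n+1≡m⊖n (row μ (suc i)) i))))))))
      , ∏-cong (λ (i , j) → +-congˡ (-‿cong (reflexive (≡.cong a (≡.sym (1-[m⊖n+1]≡n⊖m (col μ j) j)))))) (boxes μ))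
  , λ distinct μ N len≤N ev ⟦s⟧≈0 →
      ∏<-nonzero 1≉0 N _ (λ i _ → ∏<-nonzero 1≉0 (row μ (suc i)) _ (λ l l<ρ e →
          distinct _ _ (contents≢ μ i l l<ρ) (GroupProperties.x∙y⁻¹≈ε⇒x≈y +-group _ _ e)))
        (trans (sym (schur μ N len≤N ev)) ⟦s⟧≈0)
  where
  open CommutativeRing (fieldRing K)
  open PowerSeries (fieldRing K) using (nat)
  open Determinants (fieldRing K) using (∏<-cong)
  open Products (fieldRing K)
  open FieldProperties K
  schur = SpecialPoint.⟦multiSchur⟧ (fieldRing K) a (λ k → *-cancelˡ {nat (suc k)} (char0 k))
  1≉0 : ¬ 1# ≈ 0#
  1≉0 e = char0 0 (trans (+-identityʳ 1#) e)
  -- The difference of the two indices is the hook length of the box: arm plus leg plus one, hence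
  -- positive.
  contents≢ : ∀ μ i l → l < row μ (suc i) → row μ (suc i) ⊖ i ≢ suc l ⊖ col μ (suc l)
  contents≢ μ i l l<ρ e = ℤₚ.<-irrefl (≡.sym e)
    (ℤₚ.<-≤-trans (ℤₚ.⊖-monoʳ->-< (suc l) (Boundary.i<col μ i l l<ρ)) (ℤₚ.⊖-monoˡ-≤ i l<ρ))
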